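{- For all integers $k\ge 1$, $n\ge 0$ and all $$(a,b,c)\in\{(1,2,3),(1,2,5),(1,3,5)\},$$ we have $\gamma_{a,b,c,1,0}^k(n)\ge 0$; that is, the coefficient of $q^n$ in $$\frac{1}{(1-q^a)(1-q^b)(1-q^c)}\sum_{j\notin[-k,k-1]}(-1)^{j+k}q^{j^2}$$ is nonnegative.
   Context: Identities are between formal power series in $q$. The sum $\sum_{j\notin[-k,k-1]}$ is over all integers $j\le -k-1$ and all integers $j\ge k$. In general $\gamma_{a,b,c,A,B}^k(n)$ is defined by $\frac{1}{(1-q^a)(1-q^b)(1-q^c)}\sum_{j\notin[-k,k-1]}(-1)^{j+k}q^{Aj^2+Bj}=\sum_{n\ge0}\gamma_{a,b,c,A,B}^k(n)q^n$. -}

module Defs where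

open import Data.Bool using (if_then_else_; true; false)
open import Data.Fin using (Fin; toℕ) renaming (zero to fzero; suc to fsuc)
open import Data.Integer
  using (ℤ; +_; -[1+_]; 0ℤ; 1ℤ; -1ℤ; _+_; _-_; -_; _*_; _^_; ∣_∣; _≤_; _≤?_; _≟_)
open import Data.Integer.Properties
  using ( +-*-semiring; *-zeroʳ; *-identityˡ; *-assoc; *-distribʳ-+; +-assoc
        ; +-identityʳ; +-inverseˡ; +-inverseʳ; abs-*; ∣i-j∣≤∣i∣+∣j∣ )
open import Data.Nat as ℕ using (ℕ; zero; suc; NonZero; _∸_)
import Data.Nat.Properties as ℕₚ
open import Data.Product using (Σ; _,_; _×_)
open import Data.Vec.Functional using (Vector; []; _∷_)
open import Relation.Binary.PropositionalEquality
open import Relation.Nullary using (Dec; does; yes; no; contradiction)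
open import Relation.Nullary.Decidable using (_×-dec_)
open import Algebra.Properties.Semiring.Sum +-*-semiring using (sum-syntax; sum-cong-≋)

-- A formal power series is its sequence of coefficients.
PowerSeries : Set
PowerSeries = ℕ → ℤ

-- Exponents are integers only so that q^ (A j² + B j) can be written directly;
-- a negative exponent gives the zero series.
q^_ : ℤ → PowerSeries
(q^ e) n = if does (e ≟ + n) then 1ℤ else 0ℤ

1-q^_ : ℕ → PowerSeries
(1-q^ a) n = (q^ 0ℤ) n - (q^ (+ a)) n

infixl 7 _·_
_·_ : PowerSeries → PowerSeries → PowerSeries
(f · g) n = ∑[ i < suc n ] (f (toℕ i) * g (n ∸ toℕ i))

-- The first n coefficients of 1/f, highest degree first, obtained by solving
-- f · g = 1 for one coefficient at a time.
recip : PowerSeries → (n : ℕ) → Vector ℤ n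
recip f zero    = []
recip f (suc n) =
  ((q^ 0ℤ) n - ∑[ i < n ] (f (suc (toℕ i)) * recip f n i)) ∷ recip f n

-- The multiplicative inverse of a series with constant term 1, by ⁻¹-inverseʳ;
-- meaningless for other constant terms.
infix 8 _⁻¹
_⁻¹ : PowerSeries → PowerSeries
(f ⁻¹) n = recip f (suc n) fzero

recip-coeff : ∀ f n (i : Fin n) → recip f n i ≡ (f ⁻¹) (n ∸ suc (toℕ i))
recip-coeff f (suc n) fzero    = refl
recip-coeff f (suc n) (fsuc i) = recip-coeff f n i

⁻¹-inverseʳ : ∀ f → f 0 ≡ 1ℤ → ∀ n → (f · f ⁻¹) n ≡ (q^ 0ℤ) n
⁻¹-inverseʳ f f₀≡1 n = begin
  f 0 * (f ⁻¹) n + ∑[ i < n ] (f (suc (toℕ i)) * (f ⁻¹) (n ∸ suc (toℕ i)))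
    ≡⟨ cong₂ _+_ (trans (cong (_* (f ⁻¹) n) f₀≡1) (*-identityˡ ((f ⁻¹) n)))
                 (sum-cong-≋ {n} (λ i → cong (f (suc (toℕ i)) *_) (sym (recip-coeff f n i)))) ⟩
  (q^ 0ℤ) n - s + s     ≡⟨ +-assoc ((q^ 0ℤ) n) (- s) s ⟩
  (q^ 0ℤ) n + (- s + s) ≡⟨ cong (λ z → (q^ 0ℤ) n + z) (+-inverseˡ s) ⟩
  (q^ 0ℤ) n + 0ℤ        ≡⟨ +-identityʳ ((q^ 0ℤ) n) ⟩
  (q^ 0ℤ) n             ∎
  where
  open ≡-Reasoning
  s = ∑[ i < n ] (f (suc (toℕ i)) * recip f n i)

-- A family of series indexed by ℤ has a formal sum when each coefficient
-- vanishes for all but finitely many indices.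
Summable : (ℤ → PowerSeries) → Set
Summable f = ∀ n → Σ ℕ λ N → ∀ j → N ℕ.< ∣ j ∣ → f j n ≡ 0ℤ

∑∣j∣≤ : ℕ → (ℤ → ℤ) → ℤ
∑∣j∣≤ zero    t = t 0ℤ
∑∣j∣≤ (suc N) t = ∑∣j∣≤ N t + (t (+ suc N) + t -[1+ N ])

∑ℤ : (f : ℤ → PowerSeries) → Summable f → PowerSeries
∑ℤ f summable n = let (N , _) = summable n in ∑∣j∣≤ N (λ j → f j n)

_∈[-k,k-1]_ : ℤ → ℕ → Set
j ∈[-k,k-1] k = - (+ k) ≤ j × j ≤ + k - 1ℤ

_∈[-k,k-1]?_ : ∀ j k → Dec (j ∈[-k,k-1] k)
j ∈[-k,k-1]? k = (- (+ k) ≤? j) ×-dec (j ≤? + k - 1ℤ)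

exponent : ℕ → ℤ → ℤ → ℤ
exponent A B j = + A * (j * j) + B * j

-- The sign is (-1)^{j+k}; the absolute value of the exponent has the same parity.
term : ℕ → ℤ → ℕ → ℤ → PowerSeries
term A B k j n =
  if does (j ∈[-k,k-1]? k)
  then 0ℤ
  else -1ℤ ^ ∣ j + + k ∣ * (q^ exponent A B j) n

exponent-large : ∀ A .{{_ : NonZero A}} B j n →
                 n ℕ.+ ∣ B ∣ ℕ.< ∣ j ∣ → n ℕ.< ∣ exponent A B j ∣
exponent-large A B j n lt = ℕₚ.<-≤-trans n<∣l∣ (begin
  ∣ l ∣               ≤⟨ ℕₚ.m≤m*n (∣ l ∣) (∣ j ∣) {{ℕ.>-nonZero (ℕₚ.≤-<-trans ℕ.z≤n lt)}} ⟩
  ∣ l ∣ ℕ.* ∣ j ∣     ≡⟨ abs-* l j ⟨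
  ∣ l * j ∣           ≡⟨ cong ∣_∣ (trans (*-distribʳ-+ j (+ A * j) B)
                                         (cong (_+ B * j) (*-assoc (+ A) j j))) ⟩
  ∣ exponent A B j ∣  ∎)
  where
  open ℕₚ.≤-Reasoning
  l = + A * j + B
  l-B≡Aj : l - B ≡ + A * j
  l-B≡Aj = trans (+-assoc (+ A * j) B (- B))
                 (trans (cong (λ z → + A * j + z) (+-inverseʳ B)) (+-identityʳ (+ A * j)))
  n<∣l∣ : n ℕ.< ∣ l ∣
  n<∣l∣ = ℕₚ.+-cancelʳ-< (∣ B ∣) n (∣ l ∣) (begin-strict
    n ℕ.+ ∣ B ∣      <⟨ lt ⟩
    ∣ j ∣            ≤⟨ ℕₚ.m≤n*m (∣ j ∣) A ⟩
    A ℕ.* ∣ j ∣      ≡⟨ abs-* (+ A) j ⟨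
    ∣ + A * j ∣      ≡⟨ cong ∣_∣ l-B≡Aj ⟨
    ∣ l - B ∣        ≤⟨ ∣i-j∣≤∣i∣+∣j∣ l B ⟩
    ∣ l ∣ ℕ.+ ∣ B ∣  ∎)

term-summable : ∀ A .{{_ : NonZero A}} B k → Summable (term A B k)
term-summable A B k n = n ℕ.+ ∣ B ∣ , vanishes
  where
  vanishes : ∀ j → n ℕ.+ ∣ B ∣ ℕ.< ∣ j ∣ → term A B k j n ≡ 0ℤ
  vanishes j lt with does (j ∈[-k,k-1]? k) | exponent A B j ≟ + n
  ... | b | yes e≡n = contradiction (subst (λ e → n ℕ.< ∣ e ∣) e≡n (exponent-large A B j n lt))
                                    (ℕₚ.<-irrefl refl)
  ... | true  | no _ = refl
  ... | false | no _ = *-zeroʳ (-1ℤ ^ ∣ j + + k ∣)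

denominator : (a b c : ℕ) → PowerSeries
denominator a b c = (1-q^ a) · (1-q^ b) · (1-q^ c)

denominator₀ : ∀ a b c .{{_ : NonZero a}} .{{_ : NonZero b}} .{{_ : NonZero c}} →
               denominator a b c 0 ≡ 1ℤ
denominator₀ (suc _) (suc _) (suc _) = refl

-- Intended for a, b, c ≥ 1, so that the inverse is genuine by denominator₀,
-- and for exponents A j² + B j that are never negative.
γ : (a b c A : ℕ) .{{_ : NonZero A}} (B : ℤ) (k : ℕ) → PowerSeries
γ a b c A B k = denominator a b c ⁻¹ · ∑ℤ (term A B k) (term-summable A B k)

{-# OPTIONS --safe #-}
module Submission where

-- Write s = a+b+c and w = 2abc. In all three cases 1/((1-q^a)(1-q^b)(1-q^c)) has the
-- coefficients P(x) = 1 + ⌊(x² + s x)/w⌋, so that w P(x) = x² + s x + 1 + ε(x) with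
-- 0 ≤ ε(x) < w. Fix n and let G(k) be the coefficient of q^n in question. Adding the
-- sums for k and k+1 leaves only two monomials, hence
--   G(k) + G(k+1) = P(n - k²) - P(n - (k+1)²)   when (k+1)² ≤ n.
-- The quantity k (2(n - k²) + 1 + s) satisfies the recurrence of w G(k) up to the
-- values of ε, so the deviation between the two grows by less than w in absolute value
-- at each step down from M = ⌊√n⌋, where G(M) = P(n - M²) and the deviation is at most
-- M² + O(M). For 1 ≤ k < M the main term is at least 2(M² - 1) + 1 + s, which wins as
-- soon as M > s + w; the finitely many n with M ≤ s + w are evaluated.

open import Defs
open import Algebra.Bundles using (AbelianGroup)
open import Data.Bool using (if_then_else_)
open import Data.Fin using (toℕ)
open import Data.Fin.Properties using (toℕ<n)
open import Data.Integer using (0ℤ; _≤_)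
open import Data.Integer as ℤ
  using (ℤ; +_; -[1+_]; 1ℤ; -1ℤ; _+_; _-_; -_; _*_; _^_; ∣_∣; _≟_; -≤-; -≤+; +≤+)
import Data.Integer.Properties as ℤₚ
import Data.Integer.Tactic.RingSolver as ℤ-Solver
open import Data.List using (_∷_; [])
open import Data.List.Membership.Propositional using (_∈_)
open import Data.List.Relation.Unary.Any using (here; there)
open import Data.Nat using (ℕ; _≥_)
open import Data.Nat as ℕ using (zero; suc; z≤n; s≤s; _∸_; NonZero)
open import Data.Nat.DivMod using (_/_; _%_; m≡m%n+[m/n]*n; m%n<n; +-distrib-/-∣ˡ; m*n/n≡m)
open import Data.Nat.Divisibility using (n∣m*n)
open import Data.Nat.Induction using (<-rec)
import Data.Nat.Properties as ℕₚ
import Data.Nat.Tactic.RingSolver as ℕ-Solver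
open import Data.Product using (_,_; _×_; ∃₂)
open import Data.Sum using (_⊎_; inj₁; inj₂)
open import Data.Unit using (⊤; tt)
open import Function using (_∘_)
open import Relation.Binary using (Tri; tri<; tri≈; tri>)
open import Relation.Binary.PropositionalEquality
open import Relation.Nullary using (Dec; ¬_; yes; no; does; contradiction)
open import Relation.Nullary.Decidable using (_×-dec_; dec-true; dec-false; from-yes)
open import Algebra.Properties.Group (AbelianGroup.group ℤₚ.+-0-abelianGroup) using (∙-cancelʳ)
open import Algebra.Properties.Semiring.Sum ℤₚ.+-*-semiring using (sum-cong-≋)

-- Arithmetic of power series

q^-zero : ∀ {e n} → e ≢ + n → (q^ e) n ≡ 0ℤ
q^-zero {e} {n} e≢n = cong (if_then 1ℤ else 0ℤ) (dec-false (e ≟ + n) e≢n)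

·-congˡ : ∀ f {g h : PowerSeries} n → (∀ i → g i ≡ h i) → (f · g) n ≡ (f · h) n
·-congˡ f n g≡h = sum-cong-≋ {suc n} λ i → cong (f (toℕ i) *_) (g≡h (n ∸ toℕ i))

·-congʳ : ∀ {f g : PowerSeries} h n → (∀ i → f i ≡ g i) → (f · h) n ≡ (g · h) n
·-congʳ h n f≡g = sum-cong-≋ {suc n} λ i → cong (_* h (n ∸ toℕ i)) (f≡g (toℕ i))

-- The coefficient of `f · g` at `suc n` unfolds by computation to `f 0 * g (suc n)` plus the
-- coefficient of `(f ∘ suc) · g` at `n`. This law and most of those below are inductions along that
-- unfolding.
·-distribʳ-+ : ∀ f g h n → ((λ i → f i + g i) · h) n ≡ (f · h) n + (g · h) n
·-distribʳ-+ f g h zero = lemma (f 0) (g 0) (h 0)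
  where
  lemma : ∀ x y z → (x + y) * z + 0ℤ ≡ (x * z + 0ℤ) + (y * z + 0ℤ)
  lemma = ℤ-Solver.solve-∀
·-distribʳ-+ f g h (suc n) = trans
  (cong (λ z → ((f 0 + g 0) * h (suc n)) + z) (·-distribʳ-+ (f ∘ suc) (g ∘ suc) h n))
  (lemma (f 0) (g 0) (h (suc n)) ((f ∘ suc · h) n) ((g ∘ suc · h) n))
  where
  lemma : ∀ x y z u v → (x + y) * z + (u + v) ≡ (x * z + u) + (y * z + v)
  lemma = ℤ-Solver.solve-∀

·-scaleˡ : ∀ x f g n → ((λ i → x * f i) · g) n ≡ x * (f · g) n
·-scaleˡ x f g zero = lemma x (f 0) (g 0)
  where
  lemma : ∀ x y z → x * y * z + 0ℤ ≡ x * (y * z + 0ℤ)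
  lemma = ℤ-Solver.solve-∀
·-scaleˡ x f g (suc n) = trans
  (cong (λ z → x * f 0 * g (suc n) + z) (·-scaleˡ x (f ∘ suc) g n))
  (lemma x (f 0) (g (suc n)) ((f ∘ suc · g) n))
  where
  lemma : ∀ x y z u → x * y * z + x * u ≡ x * (y * z + u)
  lemma = ℤ-Solver.solve-∀

·-distribˡ-+ : ∀ f g h n → (f · (λ i → g i + h i)) n ≡ (f · g) n + (f · h) n
·-distribˡ-+ f g h zero = lemma (f 0) (g 0) (h 0)
  where
  lemma : ∀ x y z → x * (y + z) + 0ℤ ≡ (x * y + 0ℤ) + (x * z + 0ℤ)
  lemma = ℤ-Solver.solve-∀
·-distribˡ-+ f g h (suc n) = trans
  (cong (λ z → f 0 * (g (suc n) + h (suc n)) + z) (·-distribˡ-+ (f ∘ suc) g h n))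
  (lemma (f 0) (g (suc n)) (h (suc n)) ((f ∘ suc · g) n) ((f ∘ suc · h) n))
  where
  lemma : ∀ x y z u v → x * (y + z) + (u + v) ≡ (x * y + u) + (x * z + v)
  lemma = ℤ-Solver.solve-∀

·-negʳ : ∀ f g n → (f · (λ i → - g i)) n ≡ - (f · g) n
·-negʳ f g zero = lemma (f 0) (g 0)
  where
  lemma : ∀ x y → x * - y + 0ℤ ≡ - (x * y + 0ℤ)
  lemma = ℤ-Solver.solve-∀
·-negʳ f g (suc n) = trans
  (cong (λ z → f 0 * - g (suc n) + z) (·-negʳ (f ∘ suc) g n))
  (lemma (f 0) (g (suc n)) ((f ∘ suc · g) n))
  where
  lemma : ∀ x y u → x * - y + - u ≡ - (x * y + u)
  lemma = ℤ-Solver.solve-∀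

·-zeroʳ : ∀ f g n → (∀ i → i ℕ.≤ n → g i ≡ 0ℤ) → (f · g) n ≡ 0ℤ
·-zeroʳ f g zero    g≡0 = trans (cong (λ z → f 0 * z + 0ℤ) (g≡0 0 z≤n)) (trans (ℤₚ.+-identityʳ _) (ℤₚ.*-zeroʳ (f 0)))
·-zeroʳ f g (suc n) g≡0 = cong₂ _+_
  (trans (cong (f 0 *_) (g≡0 (suc n) ℕₚ.≤-refl)) (ℤₚ.*-zeroʳ (f 0)))
  (·-zeroʳ (f ∘ suc) g n (λ i i≤n → g≡0 i (ℕₚ.m≤n⇒m≤1+n i≤n)))

-- Dropping the leading coefficient of `f · g` leaves `f 0` times a shift of `g` plus
-- `(f ∘ suc) · g`. Distributivity and scaling then reduce the claim to the induction hypothesis for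
-- `f ∘ suc`.
·-assoc : ∀ f g h n → ((f · g) · h) n ≡ (f · (g · h)) n
·-assoc f g h zero = lemma (f 0) (g 0) (h 0)
  where
  lemma : ∀ x y z → (x * y + 0ℤ) * z + 0ℤ ≡ x * (y * z + 0ℤ) + 0ℤ
  lemma = ℤ-Solver.solve-∀
·-assoc f g h (suc n) = begin
  (f 0 * g 0 + 0ℤ) * h (suc n) + ((λ i → f 0 * g (suc i) + (f ∘ suc · g) i) · h) n
    ≡⟨ cong (λ z → (f 0 * g 0 + 0ℤ) * h (suc n) + z)
         (trans (·-distribʳ-+ (λ i → f 0 * g (suc i)) (f ∘ suc · g) h n)
                (cong₂ _+_ (·-scaleˡ (f 0) (g ∘ suc) h n) (·-assoc (f ∘ suc) g h n))) ⟩
  (f 0 * g 0 + 0ℤ) * h (suc n) + (f 0 * (g ∘ suc · h) n + (f ∘ suc · (g · h)) n)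
    ≡⟨ lemma (f 0) (g 0) (h (suc n)) ((g ∘ suc · h) n) ((f ∘ suc · (g · h)) n) ⟩
  f 0 * (g 0 * h (suc n) + (g ∘ suc · h) n) + (f ∘ suc · (g · h)) n ∎
  where
  open ≡-Reasoning
  lemma : ∀ x y z u v → (x * y + 0ℤ) * z + (x * u + v) ≡ x * (y * z + u) + v
  lemma = ℤ-Solver.solve-∀

0·g : ∀ g n → ((λ _ → 0ℤ) · g) n ≡ 0ℤ
0·g g zero    = refl
0·g g (suc n) = trans (ℤₚ.+-identityˡ _) (0·g g n)

q^0·g : ∀ g n → ((q^ 0ℤ) · g) n ≡ g n
q^0·g g zero    = trans (ℤₚ.+-identityʳ _) (ℤₚ.*-identityˡ (g 0))
q^0·g g (suc n) = trans (cong (λ z → 1ℤ * g (suc n) + z) (0·g g n)) (trans (ℤₚ.+-identityʳ _) (ℤₚ.*-identityˡ _))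

q^a·g : ∀ a g n → ((q^ (+ a)) · g) (a ℕ.+ n) ≡ g n
q^a·g zero    g n = q^0·g g n
q^a·g (suc a) g n = trans (ℤₚ.+-identityˡ _) (q^a·g a g n)

1-q^a·g : ∀ a g n → ((1-q^ a) · g) (a ℕ.+ n) ≡ g (a ℕ.+ n) - g n
1-q^a·g a g n = begin
  ((1-q^ a) · g) (a ℕ.+ n)
    ≡⟨ ·-distribʳ-+ (q^ 0ℤ) (λ i → - (q^ (+ a)) i) g (a ℕ.+ n) ⟩
  ((q^ 0ℤ) · g) (a ℕ.+ n) + ((λ i → - (q^ (+ a)) i) · g) (a ℕ.+ n)
    ≡⟨ cong₂ _+_ (q^0·g g (a ℕ.+ n)) (begin
         ((λ i → - (q^ (+ a)) i) · g) (a ℕ.+ n)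
           ≡⟨ ·-congʳ g (a ℕ.+ n) (λ i → sym (ℤₚ.-1*i≡-i ((q^ (+ a)) i))) ⟩
         ((λ i → -1ℤ * (q^ (+ a)) i) · g) (a ℕ.+ n)
           ≡⟨ ·-scaleˡ -1ℤ (q^ (+ a)) g (a ℕ.+ n) ⟩
         -1ℤ * ((q^ (+ a)) · g) (a ℕ.+ n)
           ≡⟨ ℤₚ.-1*i≡-i _ ⟩
         - ((q^ (+ a)) · g) (a ℕ.+ n)
           ≡⟨ cong -_ (q^a·g a g n) ⟩
         - g n ∎) ⟩
  g (a ℕ.+ n) - g n ∎
  where open ≡-Reasoning

f·q^e-below : ∀ f e n → n ℕ.< e → (f · (q^ (+ e))) n ≡ 0ℤ
f·q^e-below f e n n<e =
  ·-zeroʳ f (q^ (+ e)) n λ i i≤n → q^-zero {+ e} {i} λ where refl → ℕₚ.<⇒≱ n<e i≤n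

-- Induction on `n`, removing coefficients of `f`. Each removed one meets the monomial above degree
-- `e`, until `f n` meets degree `e` itself; whatever remains falls below `e`.
f·q^e : ∀ f e n → (f · (q^ (+ e))) (n ℕ.+ e) ≡ f n
f·q^e f zero    zero    = trans (ℤₚ.+-identityʳ _) (ℤₚ.*-identityʳ (f 0))
f·q^e f (suc e) zero    = begin
  f 0 * (q^ (+ e)) e + ((f ∘ suc) · (q^ (+ suc e))) e
    ≡⟨ cong₂ (λ x y → f 0 * x + y)
         (cong (if_then 1ℤ else 0ℤ) (dec-true (+ e ≟ + e) refl))
         (f·q^e-below (f ∘ suc) (suc e) e ℕₚ.≤-refl) ⟩
  f 0 * 1ℤ + 0ℤ ≡⟨ trans (ℤₚ.+-identityʳ _) (ℤₚ.*-identityʳ (f 0)) ⟩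
  f 0 ∎
  where open ≡-Reasoning
f·q^e f e (suc n) = begin
  f 0 * (q^ (+ e)) (suc n ℕ.+ e) + ((f ∘ suc) · (q^ (+ e))) (n ℕ.+ e)
    ≡⟨ cong₂ (λ x y → f 0 * x + y)
         (q^-zero {+ e} {suc n ℕ.+ e} λ e≡ → ℕₚ.m≢1+n+m e {n} (ℤₚ.+-injective e≡))
         (f·q^e (f ∘ suc) e n) ⟩
  f 0 * 0ℤ + f (suc n) ≡⟨ cong (_+ f (suc n)) (ℤₚ.*-zeroʳ (f 0)) ⟩
  0ℤ + f (suc n) ≡⟨ ℤₚ.+-identityˡ _ ⟩
  f (suc n) ∎
  where open ≡-Reasoning

-- Strong induction. The products of `f` with `f ⁻¹` and with `g` agree at `n`; the terms with
-- earlier coefficients of the two inverses agree by induction, and cancelling them leaves `f 0`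
-- times the two values at `n`.
⁻¹-unique : ∀ f g → f 0 ≡ 1ℤ → (∀ n → (f · g) n ≡ (q^ 0ℤ) n) → ∀ n → (f ⁻¹) n ≡ g n
⁻¹-unique f g f₀≡1 fg≡1 = <-rec _ λ n ih →
  let tails = sum-cong-≋ {n} λ i → cong (f (suc (toℕ i)) *_) (ih (ℕₚ.∸-monoʳ-< {n} ℕ.z<s (toℕ<n i)))
      heads = ∙-cancelʳ _ (f 0 * (f ⁻¹) n) (f 0 * g n) (begin
        f 0 * (f ⁻¹) n + _ ≡⟨ trans (⁻¹-inverseʳ f f₀≡1 n) (sym (fg≡1 n)) ⟩
        (f · g) n          ≡⟨ cong (λ z → f 0 * g n + z) (sym tails) ⟩
        f 0 * g n + _      ∎)
  in begin
    (f ⁻¹) n       ≡⟨ ℤₚ.*-identityˡ _ ⟨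
    1ℤ * (f ⁻¹) n  ≡⟨ cong (_* (f ⁻¹) n) f₀≡1 ⟨
    f 0 * (f ⁻¹) n ≡⟨ heads ⟩
    f 0 * g n      ≡⟨ cong (_* g n) f₀≡1 ⟩
    1ℤ * g n       ≡⟨ ℤₚ.*-identityˡ _ ⟩
    g n            ∎
  where open ≡-Reasoning

-- Sums over the integers outside [-k, k-1]

∑∣j∣≤-cong : ∀ N {s t : ℤ → ℤ} → (∀ j → s j ≡ t j) → ∑∣j∣≤ N s ≡ ∑∣j∣≤ N t
∑∣j∣≤-cong zero    s≡t = s≡t 0ℤ
∑∣j∣≤-cong (suc N) s≡t = cong₂ _+_ (∑∣j∣≤-cong N s≡t) (cong₂ _+_ (s≡t (+ suc N)) (s≡t -[1+ N ]))

∑∣j∣≤-+ : ∀ N s t → ∑∣j∣≤ N (λ j → s j + t j) ≡ ∑∣j∣≤ N s + ∑∣j∣≤ N t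
∑∣j∣≤-+ zero    s t = refl
∑∣j∣≤-+ (suc N) s t = trans
  (cong (_+ ((s (+ suc N) + t (+ suc N)) + (s -[1+ N ] + t -[1+ N ]))) (∑∣j∣≤-+ N s t))
  (lemma (∑∣j∣≤ N s) (∑∣j∣≤ N t) (s (+ suc N)) (t (+ suc N)) (s -[1+ N ]) (t -[1+ N ]))
  where
  lemma : ∀ a b x y z w → (a + b) + ((x + y) + (z + w)) ≡ (a + (x + z)) + (b + (y + w))
  lemma = ℤ-Solver.solve-∀

∑∣j∣≤-zero : ∀ N t → (∀ j → ∣ j ∣ ℕ.≤ N → t j ≡ 0ℤ) → ∑∣j∣≤ N t ≡ 0ℤ
∑∣j∣≤-zero zero    t t≡0 = t≡0 0ℤ z≤n
∑∣j∣≤-zero (suc N) t t≡0 = cong₂ _+_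
  (∑∣j∣≤-zero N t λ j j≤N → t≡0 j (ℕₚ.m≤n⇒m≤1+n j≤N))
  (cong₂ _+_ (t≡0 (+ suc N) ℕₚ.≤-refl) (t≡0 -[1+ N ] ℕₚ.≤-refl))

∑∣j∣≤-single : ∀ N t i → ∣ i ∣ ℕ.≤ N → (∀ j → j ≢ i → t j ≡ 0ℤ) → ∑∣j∣≤ N t ≡ t i
∑∣j∣≤-single zero    t (+ zero) _ _ = refl
∑∣j∣≤-single (suc N) t i i≤1+N t≡0 with ℕₚ.m≤n⇒m<n∨m≡n i≤1+N
... | inj₁ (s≤s i≤N) = trans
  (cong₂ _+_ (∑∣j∣≤-single N t i i≤N t≡0)
             (cong₂ _+_ (t≡0 (+ suc N) λ where refl → ℕₚ.<-irrefl refl i≤N)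
                        (t≡0 -[1+ N ] λ where refl → ℕₚ.<-irrefl refl i≤N)))
  (ℤₚ.+-identityʳ (t i))
∑∣j∣≤-single (suc N) t (+ .(suc N)) _ t≡0 | inj₂ refl = trans
  (cong₂ _+_ (∑∣j∣≤-zero N t λ j j≤N → t≡0 j λ where refl → ℕₚ.<-irrefl refl j≤N)
             (cong (λ z → t (+ suc N) + z) (t≡0 -[1+ N ] λ ())))
  (trans (ℤₚ.+-identityˡ _) (ℤₚ.+-identityʳ _))
∑∣j∣≤-single (suc N) t -[1+ .N ] _ t≡0 | inj₂ refl = trans
  (cong₂ _+_ (∑∣j∣≤-zero N t λ j j≤N → t≡0 j λ where refl → ℕₚ.<-irrefl refl j≤N)
             (cong (_+ t -[1+ N ]) (t≡0 (+ suc N) λ ())))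
  (trans (ℤₚ.+-identityˡ _) (ℤₚ.+-identityˡ _))

point : ℤ → ℤ → ℤ → ℤ
point i x j = if does (j ≟ i) then x else 0ℤ

point-self : ∀ i x → point i x i ≡ x
point-self i x = cong (if_then x else 0ℤ) (dec-true (i ≟ i) refl)

point-other : ∀ i j x → j ≢ i → point i x j ≡ 0ℤ
point-other i j x j≢i = cong (if_then x else 0ℤ) (dec-false (j ≟ i) j≢i)

-- If the summation window misses `i` the sum is zero, so the value has to vanish there. In use,
-- such an `i` has a square larger than the degree considered.
∑∣j∣≤-point : ∀ N i x → (N ℕ.< ∣ i ∣ → x ≡ 0ℤ) → ∑∣j∣≤ N (point i x) ≡ x
∑∣j∣≤-point N i x x≡0 with ℕₚ.≤-<-connex ∣ i ∣ N
... | inj₁ i≤N = trans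
  (∑∣j∣≤-single N (point i x) i i≤N λ j j≢i → point-other i j x j≢i)
  (point-self i x)
... | inj₂ N<i = trans
  (∑∣j∣≤-zero N (point i x) λ j j≤N → point-other i j x λ where refl → ℕₚ.<⇒≱ N<i j≤N)
  (sym (x≡0 N<i))

-- Tails of the theta-like sum and their pairwise cancellation

q^²_ : ℕ → PowerSeries
q^² m = q^ (+ (m ℕ.* m))

tail : ℕ → PowerSeries
tail k = ∑ℤ (term 1 0ℤ k) (term-summable 1 0ℤ k)

square≡∣∣² : ∀ i → i ℤ.* i ≡ + (∣ i ∣ ℕ.* ∣ i ∣)
square≡∣∣² (+ m)    = sym (ℤₚ.pos-* m m)
square≡∣∣² -[1+ m ] = refl

exponent≡∣j∣² : ∀ j → exponent 1 0ℤ j ≡ + (∣ j ∣ ℕ.* ∣ j ∣)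
exponent≡∣j∣² j = trans (lemma j) (square≡∣∣² j)
  where
  lemma : ∀ j → 1ℤ * (j * j) + 0ℤ * j ≡ j * j
  lemma = ℤ-Solver.solve-∀

-- With the bound written as `suc k`, the ends of the interval compute to `-[1+ k ]` and `+ k`. For
-- negative `j` the estimate is one weaker than what holds, to cover both signs.
∉⇒k≤∣j∣ : ∀ k j → ¬ (j ∈[-k,k-1] suc k) → suc k ℕ.≤ ∣ j ∣
∉⇒k≤∣j∣ k (+ m)    j∉ = ℕₚ.≰⇒> λ m≤k → j∉ (-≤+ , +≤+ m≤k)
∉⇒k≤∣j∣ k -[1+ m ] j∉ = s≤s (ℕₚ.<⇒≤ (ℕₚ.≰⇒> λ m≤k → j∉ (-≤- m≤k , -≤+)))

∈-suc : ∀ k {j} → j ∈[-k,k-1] suc k → j ∈[-k,k-1] suc (suc k)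
∈-suc k (l , u) = ℤₚ.≤-trans (-≤- (ℕₚ.n≤1+n k)) l , ℤₚ.≤-trans u (+≤+ (ℕₚ.n≤1+n k))

∈-boundary : ∀ k j → ¬ (j ∈[-k,k-1] suc k) → j ∈[-k,k-1] suc (suc k) → j ≡ + suc k ⊎ j ≡ -[1+ suc k ]
∈-boundary k (+ m)    j∉ (_ , +≤+ m≤1+k) = inj₁ (cong +_ (ℕₚ.≤-antisym m≤1+k (∉⇒k≤∣j∣ k (+ m) j∉)))
∈-boundary k -[1+ m ] j∉ (-≤- m≤1+k , _) =
  inj₂ (cong -[1+_] (ℕₚ.≤-antisym m≤1+k (ℕₚ.≰⇒> λ m≤k → j∉ (-≤- m≤k , -≤+))))

sign-suc : ∀ i → -1ℤ ^ ∣ i + 1ℤ ∣ ≡ - (-1ℤ ^ ∣ i ∣)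
sign-suc (+ m)        = trans (cong (-1ℤ ^_) (ℕₚ.+-comm m 1)) (ℤₚ.-1*i≡-i _)
sign-suc -[1+ zero ]  = refl
sign-suc -[1+ suc m ] = sym (trans (cong -_ (ℤₚ.-1*i≡-i (-1ℤ ^ suc m))) (ℤₚ.neg-involutive _))

sign-double : ∀ m → -1ℤ ^ (m ℕ.+ m) ≡ 1ℤ
sign-double zero    = refl
sign-double (suc m) rewrite ℕₚ.+-suc m m | sign-double m = refl

term-inside : ∀ k {j} n → j ∈[-k,k-1] k → term 1 0ℤ k j n ≡ 0ℤ
term-inside k {j} n j∈ = cong (if_then 0ℤ else (-1ℤ ^ ∣ j + + k ∣ * (q^ exponent 1 0ℤ j) n))
  (dec-true (j ∈[-k,k-1]? k) j∈)

term-outside : ∀ k {j} n → ¬ (j ∈[-k,k-1] k) →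
               term 1 0ℤ k j n ≡ -1ℤ ^ ∣ j + + k ∣ * (q^² ∣ j ∣) n
term-outside k {j} n j∉ = trans
  (cong (if_then 0ℤ else (-1ℤ ^ ∣ j + + k ∣ * (q^ exponent 1 0ℤ j) n))
    (dec-false (j ∈[-k,k-1]? k) j∉))
  (cong (λ e → -1ℤ ^ ∣ j + + k ∣ * (q^ e) n) (exponent≡∣j∣² j))

-- The k-th and (k+1)-st sums cancel except at j = k and j = -k-1.
term-step : ∀ k j n →
  term 1 0ℤ (suc k) j n + term 1 0ℤ (suc (suc k)) j n ≡
  point (+ suc k) ((q^² suc k) n) j +
  point -[1+ suc k ] (- (q^² suc (suc k)) n) j
term-step k j n with j ∈[-k,k-1]? suc k | j ∈[-k,k-1]? suc (suc k)
... | yes j∈ | no j∉ = contradiction (∈-suc k j∈) j∉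
... | yes j∈@(l , u) | yes j∈′ = trans
  (cong₂ _+_ (term-inside (suc k) n j∈) (term-inside (suc (suc k)) n j∈′))
  (sym (cong₂ _+_
    (point-other (+ suc k) j _ λ where refl → ℕₚ.<-irrefl refl (ℤₚ.drop‿+≤+ u))
    (point-other -[1+ suc k ] j _ λ where refl → ℕₚ.<-irrefl refl (ℤₚ.drop‿-≤- l))))
-- Outside both intervals the same monomial occurs twice, and raising the bound by one flips its
-- sign.
... | no j∉ | no j∉′ = begin
  term 1 0ℤ (suc k) j n + term 1 0ℤ (suc (suc k)) j n
    ≡⟨ cong₂ _+_ (term-outside (suc k) n j∉) (term-outside (suc (suc k)) n j∉′) ⟩
  -1ℤ ^ ∣ j + + suc k ∣ * x + -1ℤ ^ ∣ j + + suc (suc k) ∣ * x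
    ≡⟨ cong (λ z → -1ℤ ^ ∣ j + + suc k ∣ * x + z * x)
         (trans (cong (λ i → -1ℤ ^ ∣ i ∣) (shift j (+ suc k))) (sign-suc (j + + suc k))) ⟩
  -1ℤ ^ ∣ j + + suc k ∣ * x + - (-1ℤ ^ ∣ j + + suc k ∣) * x
    ≡⟨ cancel (-1ℤ ^ ∣ j + + suc k ∣) x ⟩
  0ℤ
    ≡⟨ cong₂ _+_
         (point-other (+ suc k) j _ λ where refl → j∉′ (-≤+ , +≤+ ℕₚ.≤-refl))
         (point-other -[1+ suc k ] j _ λ where refl → j∉′ (-≤- ℕₚ.≤-refl , -≤+)) ⟨
  point (+ suc k) _ j + point -[1+ suc k ] _ j ∎
  where
  open ≡-Reasoning
  x = (q^² ∣ j ∣) n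
  shift : ∀ i l → i + (1ℤ + l) ≡ (i + l) + 1ℤ
  shift = ℤ-Solver.solve-∀
  cancel : ∀ y z → y * z + - y * z ≡ 0ℤ
  cancel = ℤ-Solver.solve-∀
... | no j∉ | yes j∈ with ∈-boundary k j j∉ j∈
-- At the upper end the sign exponent is a doubled number, hence even.
... | inj₁ refl = cong₂ _+_
  (begin
    term 1 0ℤ (suc k) (+ suc k) n   ≡⟨ term-outside (suc k) n j∉ ⟩
    -1ℤ ^ (suc k ℕ.+ suc k) * x     ≡⟨ cong (_* x) (sign-double (suc k)) ⟩
    1ℤ * x                          ≡⟨ ℤₚ.*-identityˡ x ⟩
    x                               ≡⟨ point-self (+ suc k) x ⟨
    point (+ suc k) x (+ suc k)     ∎)
  (term-inside (suc (suc k)) n j∈)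
  where
  open ≡-Reasoning
  x = (q^² suc k) n
... | inj₂ refl = begin
  term 1 0ℤ (suc k) -[1+ suc k ] n + term 1 0ℤ (suc (suc k)) -[1+ suc k ] n
    ≡⟨ cong₂ _+_ (term-outside (suc k) n j∉) (term-inside (suc (suc k)) n j∈) ⟩
  -1ℤ ^ ∣ -[1+ suc k ] + + suc k ∣ * y + 0ℤ
    -- The sign exponent is the absolute value of -(k+2) + (k+1), which is 1.
    ≡⟨ cong (λ m → -1ℤ ^ m * y + 0ℤ)
         (trans (ℤₚ.∣⊖∣-< (ℕₚ.n<1+n (suc k))) (ℕₚ.m+n∸n≡m 1 k)) ⟩
  -1ℤ * y + 0ℤ
    ≡⟨ trans (ℤₚ.+-comm (-1ℤ * y) 0ℤ) (cong (λ z → 0ℤ + z) (ℤₚ.-1*i≡-i y)) ⟩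
  0ℤ + - y
    ≡⟨ cong (λ z → 0ℤ + z) (point-self -[1+ suc k ] (- y)) ⟨
  0ℤ + point -[1+ suc k ] (- y) -[1+ suc k ] ∎
  where
  open ≡-Reasoning
  y = (q^² suc (suc k)) n

tail-step : ∀ k n → tail (suc k) n + tail (suc (suc k)) n ≡
                    (q^² suc k) n + - (q^² suc (suc k)) n
tail-step k n = begin
  tail (suc k) n + tail (suc (suc k)) n
    ≡⟨ ∑∣j∣≤-+ N (λ j → term 1 0ℤ (suc k) j n) (λ j → term 1 0ℤ (suc (suc k)) j n) ⟨
  ∑∣j∣≤ N (λ j → term 1 0ℤ (suc k) j n + term 1 0ℤ (suc (suc k)) j n)
    ≡⟨ ∑∣j∣≤-cong N (λ j → term-step k j n) ⟩
  ∑∣j∣≤ N (λ j → point (+ suc k) x j + point -[1+ suc k ] (- y) j)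
    ≡⟨ ∑∣j∣≤-+ N (point (+ suc k) x) (point -[1+ suc k ] (- y)) ⟩
  ∑∣j∣≤ N (point (+ suc k) x) + ∑∣j∣≤ N (point -[1+ suc k ] (- y))
    ≡⟨ cong₂ _+_ (∑∣j∣≤-point N (+ suc k) x (vanish (suc k)))
                 (∑∣j∣≤-point N -[1+ suc k ] (- y) λ N<k → cong -_ (vanish (suc (suc k)) N<k)) ⟩
  x + - y ∎
  where
  open ≡-Reasoning
  -- This is the cutoff that `term-summable` gives for `B = 0`. It is the same for both tails, so
  -- their sums combine term by term.
  N = n ℕ.+ 0
  x = (q^² suc k) n
  y = (q^² suc (suc k)) n
  vanish : ∀ m → N ℕ.< m → (q^² m) n ≡ 0ℤ
  vanish (suc m) N<m = q^-zero {+ (suc m ℕ.* suc m)} λ m²≡n → ℕₚ.<⇒≱ N<m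
    (ℕₚ.≤-trans (ℕₚ.m≤m*n (suc m) (suc m))
      (ℕₚ.≤-trans (ℕₚ.≤-reflexive (ℤₚ.+-injective m²≡n)) (ℕₚ.m≤m+n n 0)))

tail-zero : ∀ k n → n ℕ.< suc k ℕ.* suc k → tail (suc k) n ≡ 0ℤ
tail-zero k n n<k² = ∑∣j∣≤-zero (n ℕ.+ 0) (λ j → term 1 0ℤ (suc k) j n) λ j _ → vanish j
  where
  vanish : ∀ j → term 1 0ℤ (suc k) j n ≡ 0ℤ
  vanish j with j ∈[-k,k-1]? suc k
  ... | yes j∈ = term-inside (suc k) n j∈
  ... | no j∉  = trans (term-outside (suc k) n j∉) (trans
    (cong (-1ℤ ^ ∣ j + + suc k ∣ *_) (q^-zero {+ (∣ j ∣ ℕ.* ∣ j ∣)} λ j²≡n → ℕₚ.<⇒≱ n<k² (ℕₚ.≤-trans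
      (ℕₚ.*-mono-≤ (∉⇒k≤∣j∣ k j j∉) (∉⇒k≤∣j∣ k j j∉))
      (ℕₚ.≤-reflexive (ℤₚ.+-injective j²≡n)))))
    (ℤₚ.*-zeroʳ (-1ℤ ^ ∣ j + + suc k ∣)))

-- Growth of solutions of the alternating recurrence

∣+m-+n∣≤ : ∀ {b m n} → m ℕ.≤ b → n ℕ.≤ b → ∣ + m ℤ.- + n ∣ ℕ.≤ b
∣+m-+n∣≤ {b} {m} {n} m≤b n≤b = begin
  ∣ + m ℤ.- + n ∣  ≡⟨ cong ∣_∣ (ℤₚ.m-n≡m⊖n m n) ⟩
  ∣ m ℤ.⊖ n ∣      ≤⟨ ℤₚ.∣m⊝n∣≤m⊔n m n ⟩
  m ℕ.⊔ n          ≤⟨ ℕₚ.⊔-lub m≤b n≤b ⟩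
  b                ∎
  where open ℕₚ.≤-Reasoning

-- G k stands for the coefficient of q^n in (∑ P(i) q^i) · (q^(k²) - 2 q^((k+1)²) + 2 q^((k+2)²) - …).
module Alternating
  (s w E : ℕ) (P ε : ℕ → ℕ)
  (quadratic : ∀ x → w ℕ.* P x ≡ x ℕ.* x ℕ.+ s ℕ.* x ℕ.+ 1 ℕ.+ ε x)
  (ε≤E : ∀ x → ε x ℕ.≤ E)
  (n : ℕ) (G : ℕ → ℤ)
  (step : ∀ k x y → x ℕ.+ suc k ℕ.* suc k ≡ n → y ℕ.+ suc (suc k) ℕ.* suc (suc k) ≡ n →
          G (suc k) ℤ.+ G (suc (suc k)) ≡ + P x ℤ.- + P y)
  (M r : ℕ) (r≤2M : r ℕ.≤ M ℕ.+ M) (r+M²≡n : r ℕ.+ M ℕ.* M ≡ n) (last : G M ≡ + P r)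
  where

  quadraticℤ : ∀ x → + w ℤ.* + P x ≡ + x ℤ.* + x ℤ.+ + s ℤ.* + x ℤ.+ 1ℤ ℤ.+ + ε x
  quadraticℤ x = begin
    + w ℤ.* + P x                                 ≡⟨ ℤₚ.pos-* w (P x) ⟨
    + (w ℕ.* P x)                                 ≡⟨ cong +_ (quadratic x) ⟩
    + (x ℕ.* x) ℤ.+ + (s ℕ.* x) ℤ.+ 1ℤ ℤ.+ + ε x
      ≡⟨ cong₂ (λ i j → i ℤ.+ j ℤ.+ 1ℤ ℤ.+ + ε x) (ℤₚ.pos-* x x) (ℤₚ.pos-* s x) ⟩
    + x ℤ.* + x ℤ.+ + s ℤ.* + x ℤ.+ 1ℤ ℤ.+ + ε x ∎
    where open ≡-Reasoning

  -- If ε vanished, k (2x + 1 + s) with x = n - k² would satisfy the recurrence of w G k exactly.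
  main : ℕ → ℕ → ℕ
  main k x = k ℕ.* (2 ℕ.* x ℕ.+ 1 ℕ.+ s)

  deviation : ℕ → ℕ → ℤ
  deviation k x = + w ℤ.* G k ℤ.- + k ℤ.* (+ 2 ℤ.* + x ℤ.+ 1ℤ ℤ.+ + s)

  deviation+main : ∀ k x → deviation k x ℤ.+ + main k x ≡ + w ℤ.* G k
  deviation+main k x = begin
    deviation k x ℤ.+ + main k x
      ≡⟨ cong (λ i → deviation k x ℤ.+ i) (trans (ℤₚ.pos-* k _)
           (cong (λ i → + k ℤ.* (i ℤ.+ 1ℤ ℤ.+ + s)) (ℤₚ.pos-* 2 x))) ⟩
    deviation k x ℤ.+ + k ℤ.* (+ 2 ℤ.* + x ℤ.+ 1ℤ ℤ.+ + s)
      ≡⟨ lemma (+ w ℤ.* G k) _ ⟩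
    + w ℤ.* G k ∎
    where
    open ≡-Reasoning
    lemma : ∀ i j → i ℤ.- j ℤ.+ j ≡ i
    lemma = ℤ-Solver.solve-∀

  -- With K = k+1 we have x = y + 2K + 1, and K(2x+1+s) + (K+1)(2y+1+s) equals (x² + sx) - (y² +
  -- sy). The main terms therefore cancel and only the values of `ε` remain.
  deviation-step : ∀ k x y → x ℕ.+ suc k ℕ.* suc k ≡ n → y ℕ.+ suc (suc k) ℕ.* suc (suc k) ≡ n →
                   deviation (suc k) x ≡ (+ ε x ℤ.- + ε y) ℤ.- deviation (suc (suc k)) y
  deviation-step k x y x+k²≡n y+[1+k]²≡n = begin
    W ℤ.* G (suc k) ℤ.- K ℤ.* (+ 2 ℤ.* + x ℤ.+ 1ℤ ℤ.+ S)
      ≡⟨ split W (G (suc k)) (G (suc (suc k))) _ ⟩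
    W ℤ.* (G (suc k) ℤ.+ G (suc (suc k))) ℤ.- W ℤ.* G (suc (suc k)) ℤ.- K ℤ.* (+ 2 ℤ.* + x ℤ.+ 1ℤ ℤ.+ S)
      ≡⟨ cong (λ i → W ℤ.* i ℤ.- W ℤ.* G (suc (suc k)) ℤ.- K ℤ.* (+ 2 ℤ.* + x ℤ.+ 1ℤ ℤ.+ S))
           (step k x y x+k²≡n y+[1+k]²≡n) ⟩
    W ℤ.* (+ P x ℤ.- + P y) ℤ.- W ℤ.* G (suc (suc k)) ℤ.- K ℤ.* (+ 2 ℤ.* + x ℤ.+ 1ℤ ℤ.+ S)
      ≡⟨ distribute W (+ P x) (+ P y) _ _ ⟩
    (W ℤ.* + P x ℤ.- W ℤ.* + P y) ℤ.- W ℤ.* G (suc (suc k)) ℤ.- K ℤ.* (+ 2 ℤ.* + x ℤ.+ 1ℤ ℤ.+ S)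
      ≡⟨ cong₂ (λ i j → (i ℤ.- j) ℤ.- W ℤ.* G (suc (suc k)) ℤ.- K ℤ.* (+ 2 ℤ.* + x ℤ.+ 1ℤ ℤ.+ S))
           (quadraticℤ x) (quadraticℤ y) ⟩
    expand (+ x)
      ≡⟨ cong expand x≡ ⟩
    expand (+ y ℤ.+ K ℤ.+ K ℤ.+ 1ℤ)
      ≡⟨ collect S (W ℤ.* G (suc (suc k))) (+ ε x) (+ ε y) K (+ y) ⟩
    (+ ε x ℤ.- + ε y) ℤ.- deviation (suc (suc k)) y ∎
    where
    open ≡-Reasoning
    W = + w
    S = + s
    K = + suc k
    expand : ℤ → ℤ
    expand X = ((X ℤ.* X ℤ.+ S ℤ.* X ℤ.+ 1ℤ ℤ.+ + ε x) ℤ.-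
                (+ y ℤ.* + y ℤ.+ S ℤ.* + y ℤ.+ 1ℤ ℤ.+ + ε y))
               ℤ.- W ℤ.* G (suc (suc k)) ℤ.- K ℤ.* (+ 2 ℤ.* X ℤ.+ 1ℤ ℤ.+ S)
    square : ∀ k y → y ℕ.+ suc k ℕ.* suc k ≡ (y ℕ.+ k ℕ.+ k ℕ.+ 1) ℕ.+ k ℕ.* k
    square = ℕ-Solver.solve-∀
    x≡ : + x ≡ + y ℤ.+ K ℤ.+ K ℤ.+ 1ℤ
    x≡ = cong +_ (ℕₚ.+-cancelʳ-≡ (suc k ℕ.* suc k) x _
           (trans x+k²≡n (trans (sym y+[1+k]²≡n) (square (suc k) y))))
    split : ∀ W g h i → W ℤ.* g ℤ.- i ≡ W ℤ.* (g ℤ.+ h) ℤ.- W ℤ.* h ℤ.- i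
    split = ℤ-Solver.solve-∀
    distribute : ∀ W a b h i → W ℤ.* (a ℤ.- b) ℤ.- h ℤ.- i ≡ (W ℤ.* a ℤ.- W ℤ.* b) ℤ.- h ℤ.- i
    distribute = ℤ-Solver.solve-∀
    collect : ∀ S h a b K Y → let X = Y ℤ.+ K ℤ.+ K ℤ.+ 1ℤ in
      ((X ℤ.* X ℤ.+ S ℤ.* X ℤ.+ 1ℤ ℤ.+ a) ℤ.- (Y ℤ.* Y ℤ.+ S ℤ.* Y ℤ.+ 1ℤ ℤ.+ b))
        ℤ.- h ℤ.- K ℤ.* (+ 2 ℤ.* X ℤ.+ 1ℤ ℤ.+ S) ≡
      (a ℤ.- b) ℤ.- (h ℤ.- (1ℤ ℤ.+ K) ℤ.* (+ 2 ℤ.* Y ℤ.+ 1ℤ ℤ.+ S))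
    collect = ℤ-Solver.solve-∀

  last-bound : ℕ
  last-bound = M ℕ.* M ℕ.+ s ℕ.* M ℕ.+ (1 ℕ.+ E) ℕ.+ M

  -- Put v = r - M. Completing the square turns the deviation into (v² - M²) + s v + (1 + ε r) - M,
  -- and `r≤2M` gives |v| ≤ M, hence |v² - M²| ≤ M².
  ∣deviation-last∣≤ : ∣ deviation M r ∣ ℕ.≤ last-bound
  ∣deviation-last∣≤ = begin
    ∣ deviation M r ∣
      ≡⟨ cong (λ i → ∣ i ℤ.- + M ℤ.* (+ 2 ℤ.* + r ℤ.+ 1ℤ ℤ.+ + s) ∣)
           (trans (cong (+ w ℤ.*_) last) (quadraticℤ r)) ⟩
    ∣ (+ r ℤ.* + r ℤ.+ + s ℤ.* + r ℤ.+ 1ℤ ℤ.+ + ε r) ℤ.- + M ℤ.* (+ 2 ℤ.* + r ℤ.+ 1ℤ ℤ.+ + s) ∣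
      ≡⟨ cong ∣_∣ (centre (+ r) (+ M) (+ s) (+ ε r)) ⟩
    ∣ (v ℤ.* v ℤ.- + M ℤ.* + M) ℤ.+ + s ℤ.* v ℤ.+ (1ℤ ℤ.+ + ε r) ℤ.- + M ∣
      ≤⟨ ℤₚ.∣i-j∣≤∣i∣+∣j∣ ((v ℤ.* v ℤ.- + M ℤ.* + M) ℤ.+ + s ℤ.* v ℤ.+ (1ℤ ℤ.+ + ε r)) (+ M) ⟩
    ∣ (v ℤ.* v ℤ.- + M ℤ.* + M) ℤ.+ + s ℤ.* v ℤ.+ (1ℤ ℤ.+ + ε r) ∣ ℕ.+ M
      ≤⟨ ℕₚ.+-monoˡ-≤ M (ℤₚ.∣i+j∣≤∣i∣+∣j∣ ((v ℤ.* v ℤ.- + M ℤ.* + M) ℤ.+ + s ℤ.* v) _) ⟩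
    ∣ (v ℤ.* v ℤ.- + M ℤ.* + M) ℤ.+ + s ℤ.* v ∣ ℕ.+ (1 ℕ.+ ε r) ℕ.+ M
      ≤⟨ ℕₚ.+-monoˡ-≤ M (ℕₚ.+-mono-≤
           (ℕₚ.≤-trans (ℤₚ.∣i+j∣≤∣i∣+∣j∣ (v ℤ.* v ℤ.- + M ℤ.* + M) _) (ℕₚ.+-mono-≤ ∣v²-M²∣≤M² ∣sv∣≤sM))
           (s≤s (ε≤E r))) ⟩
    M ℕ.* M ℕ.+ s ℕ.* M ℕ.+ (1 ℕ.+ E) ℕ.+ M ∎
    where
    open ℕₚ.≤-Reasoning
    v = + r ℤ.- + M
    ∣v∣≤M : ∣ v ∣ ℕ.≤ M
    ∣v∣≤M with ℕₚ.≤-total r M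
    ... | inj₁ r≤M = begin
      ∣ v ∣        ≡⟨ cong ∣_∣ (ℤₚ.m-n≡m⊖n r M) ⟩
      ∣ r ℤ.⊖ M ∣  ≡⟨ ℤₚ.∣⊖∣-≤ r≤M ⟩
      M ∸ r        ≤⟨ ℕₚ.m∸n≤m M r ⟩
      M            ∎
    ... | inj₂ M≤r = begin
      ∣ v ∣        ≡⟨ cong ∣_∣ (trans (ℤₚ.m-n≡m⊖n r M) (ℤₚ.⊖-≥ M≤r)) ⟩
      r ∸ M        ≤⟨ ℕₚ.m≤n+o⇒m∸n≤o r M r≤2M ⟩
      M            ∎
    ∣v²-M²∣≤M² : ∣ v ℤ.* v ℤ.- + M ℤ.* + M ∣ ℕ.≤ M ℕ.* M
    ∣v²-M²∣≤M² = begin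
      ∣ v ℤ.* v ℤ.- + M ℤ.* + M ∣
        ≡⟨ cong₂ (λ i j → ∣ i ℤ.- j ∣) (square≡∣∣² v) (sym (ℤₚ.pos-* M M)) ⟩
      ∣ + (∣ v ∣ ℕ.* ∣ v ∣) ℤ.- + (M ℕ.* M) ∣
        ≤⟨ ∣+m-+n∣≤ (ℕₚ.*-mono-≤ ∣v∣≤M ∣v∣≤M) ℕₚ.≤-refl ⟩
      M ℕ.* M ∎
    ∣sv∣≤sM : ∣ + s ℤ.* v ∣ ℕ.≤ s ℕ.* M
    ∣sv∣≤sM = begin
      ∣ + s ℤ.* v ∣  ≡⟨ ℤₚ.abs-* (+ s) v ⟩
      s ℕ.* ∣ v ∣    ≤⟨ ℕₚ.*-monoʳ-≤ s ∣v∣≤M ⟩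
      s ℕ.* M        ∎
    centre : ∀ r M s e →
      (r ℤ.* r ℤ.+ s ℤ.* r ℤ.+ 1ℤ ℤ.+ e) ℤ.- M ℤ.* (+ 2 ℤ.* r ℤ.+ 1ℤ ℤ.+ s) ≡
      ((r ℤ.- M) ℤ.* (r ℤ.- M) ℤ.- M ℤ.* M) ℤ.+ s ℤ.* (r ℤ.- M) ℤ.+ (1ℤ ℤ.+ e) ℤ.- M
    centre = ℤ-Solver.solve-∀

  -- Induction on the distance `d` to `M`: each step down contributes a difference of two values of
  -- `ε`, both in [0, E], so at most `E` in absolute value.
  ∣deviation∣≤ : ∀ d k x → suc k ℕ.+ d ≡ M → x ℕ.+ suc k ℕ.* suc k ≡ n →
                ∣ deviation (suc k) x ∣ ℕ.≤ E ℕ.* d ℕ.+ last-bound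
  ∣deviation∣≤ zero k x k≡M x+k²≡n with trans (sym (ℕₚ.+-identityʳ (suc k))) k≡M
  ... | refl with ℕₚ.+-cancelʳ-≡ (suc k ℕ.* suc k) x r (trans x+k²≡n (sym r+M²≡n))
  ... | refl = ℕₚ.≤-trans ∣deviation-last∣≤ (ℕₚ.m≤n+m last-bound (E ℕ.* 0))
  ∣deviation∣≤ (suc d) k x k+1+d≡M x+k²≡n = begin
    ∣ deviation (suc k) x ∣
      ≡⟨ cong ∣_∣ (deviation-step k x y x+k²≡n y+[1+k]²≡n) ⟩
    ∣ (+ ε x ℤ.- + ε y) ℤ.- deviation (suc (suc k)) y ∣
      ≤⟨ ℤₚ.∣i-j∣≤∣i∣+∣j∣ (+ ε x ℤ.- + ε y) _ ⟩
    ∣ + ε x ℤ.- + ε y ∣ ℕ.+ ∣ deviation (suc (suc k)) y ∣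
      ≤⟨ ℕₚ.+-mono-≤ (∣+m-+n∣≤ (ε≤E x) (ε≤E y)) (∣deviation∣≤ d (suc k) y 1+k+d≡M y+[1+k]²≡n) ⟩
    E ℕ.+ (E ℕ.* d ℕ.+ last-bound)
      ≡⟨ trans (sym (ℕₚ.+-assoc E _ _)) (cong (ℕ._+ last-bound) (sym (ℕₚ.*-suc E d))) ⟩
    E ℕ.* suc d ℕ.+ last-bound ∎
    where
    open ℕₚ.≤-Reasoning
    1+k+d≡M : suc (suc k) ℕ.+ d ≡ M
    1+k+d≡M = trans (sym (ℕₚ.+-suc (suc k) d)) k+1+d≡M
    1+k≤M : suc (suc k) ℕ.≤ M
    1+k≤M = ℕₚ.m+n≤o⇒m≤o _ (ℕₚ.≤-reflexive 1+k+d≡M)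
    y = n ∸ suc (suc k) ℕ.* suc (suc k)
    y+[1+k]²≡n : y ℕ.+ suc (suc k) ℕ.* suc (suc k) ≡ n
    y+[1+k]²≡n = ℕₚ.m∸n+n≡m (ℕₚ.≤-trans (ℕₚ.*-mono-≤ 1+k≤M 1+k≤M)
                               (ℕₚ.≤-trans (ℕₚ.m≤n+m _ r) (ℕₚ.≤-reflexive r+M²≡n)))

  -- Writing k = 1 + i, M - k = 1 + j, the main term is at least 2 (M² - 1) + 1 + s
  -- because k (M - k) ≥ M - 1 and M + k ≥ M + 1.
  bound≤main : ∀ i j x → suc i ℕ.+ suc j ≡ M → s ℕ.+ E ℕ.+ 2 ℕ.≤ M → x ℕ.+ suc i ℕ.* suc i ≡ n →
               E ℕ.* suc j ℕ.+ last-bound ℕ.≤ main (suc i) x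
  -- Adding `M` to both sides makes the linear terms at most (s + E + 2) M, which `large` bounds by
  -- M².
  bound≤main i j x k+d≡M large x+k²≡n = ℕₚ.+-cancelʳ-≤ M _ _ (begin
    E ℕ.* suc j ℕ.+ (M ℕ.* M ℕ.+ s ℕ.* M ℕ.+ (1 ℕ.+ E) ℕ.+ M) ℕ.+ M
      ≡⟨ regroup E j M s ⟩
    E ℕ.* suc (suc j) ℕ.+ (M ℕ.* M ℕ.+ s ℕ.* M ℕ.+ 1 ℕ.+ M ℕ.+ M)
      ≤⟨ ℕₚ.+-monoˡ-≤ _ (ℕₚ.*-monoʳ-≤ E d<M) ⟩
    E ℕ.* M ℕ.+ (M ℕ.* M ℕ.+ s ℕ.* M ℕ.+ 1 ℕ.+ M ℕ.+ M)
      ≡⟨ factor E M s ⟩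
    (s ℕ.+ E ℕ.+ 2) ℕ.* M ℕ.+ (M ℕ.* M ℕ.+ 1)
      ≤⟨ ℕₚ.+-monoˡ-≤ _ (ℕₚ.*-monoˡ-≤ M large) ⟩
    M ℕ.* M ℕ.+ (M ℕ.* M ℕ.+ 1)
      ≡⟨ cong (λ m → m ℕ.* m ℕ.+ (m ℕ.* m ℕ.+ 1)) (sym k+d≡M) ⟩
    (suc i ℕ.+ suc j) ℕ.* (suc i ℕ.+ suc j) ℕ.+ ((suc i ℕ.+ suc j) ℕ.* (suc i ℕ.+ suc j) ℕ.+ 1)
      ≤⟨ ℕₚ.m≤m+n _ (slack i j) ⟩
    (suc i ℕ.+ suc j) ℕ.* (suc i ℕ.+ suc j) ℕ.+ ((suc i ℕ.+ suc j) ℕ.* (suc i ℕ.+ suc j) ℕ.+ 1) ℕ.+ slack i j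
      ≡⟨ compare s r i j ⟩
    main (suc i) (r ℕ.+ suc j ℕ.* (3 ℕ.+ 2 ℕ.* i ℕ.+ j)) ℕ.+ (suc i ℕ.+ suc j)
      ≡⟨ cong₂ (λ y m → main (suc i) y ℕ.+ m) (sym x≡) k+d≡M ⟩
    main (suc i) x ℕ.+ M ∎)
    where
    open ℕₚ.≤-Reasoning
    d<M : suc (suc j) ℕ.≤ M
    d<M = ℕₚ.≤-trans (s≤s (ℕₚ.m≤n+m (suc j) i)) (ℕₚ.≤-reflexive k+d≡M)
    -- The excess of `main (suc i) x + M` over 2M² + 1, expanded so that every summand is visibly
    -- nonnegative.
    slack : ℕ → ℕ → ℕ
    slack i j = 2 ℕ.* (i ℕ.* (1 ℕ.+ i ℕ.+ j) ℕ.+ i ℕ.* j ℕ.* (3 ℕ.+ 2 ℕ.* i ℕ.+ j)) ℕ.+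
                (s ℕ.+ i ℕ.* (1 ℕ.+ s) ℕ.+ i ℕ.+ j) ℕ.+ 2 ℕ.* r ℕ.* suc i
    -- From x = r + M² - k² = r + (M - k)(M + k), where M + k = 3 + 2i + j.
    x≡ : x ≡ r ℕ.+ suc j ℕ.* (3 ℕ.+ 2 ℕ.* i ℕ.+ j)
    x≡ = ℕₚ.+-cancelʳ-≡ (suc i ℕ.* suc i) x _
      (trans x+k²≡n (trans (sym r+M²≡n)
        (trans (cong (λ m → r ℕ.+ m ℕ.* m) (sym k+d≡M)) (difference r i j))))
      where
      difference : ∀ r i j → r ℕ.+ (suc i ℕ.+ suc j) ℕ.* (suc i ℕ.+ suc j) ≡
                             r ℕ.+ suc j ℕ.* (3 ℕ.+ 2 ℕ.* i ℕ.+ j) ℕ.+ suc i ℕ.* suc i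
      difference = ℕ-Solver.solve-∀
    regroup : ∀ E j M s → E ℕ.* suc j ℕ.+ (M ℕ.* M ℕ.+ s ℕ.* M ℕ.+ (1 ℕ.+ E) ℕ.+ M) ℕ.+ M ≡
                          E ℕ.* suc (suc j) ℕ.+ (M ℕ.* M ℕ.+ s ℕ.* M ℕ.+ 1 ℕ.+ M ℕ.+ M)
    regroup = ℕ-Solver.solve-∀
    factor : ∀ E M s → E ℕ.* M ℕ.+ (M ℕ.* M ℕ.+ s ℕ.* M ℕ.+ 1 ℕ.+ M ℕ.+ M) ≡
                       (s ℕ.+ E ℕ.+ 2) ℕ.* M ℕ.+ (M ℕ.* M ℕ.+ 1)
    factor = ℕ-Solver.solve-∀
    compare : ∀ s r i j →
      (suc i ℕ.+ suc j) ℕ.* (suc i ℕ.+ suc j) ℕ.+ ((suc i ℕ.+ suc j) ℕ.* (suc i ℕ.+ suc j) ℕ.+ 1) ℕ.+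
        (2 ℕ.* (i ℕ.* (1 ℕ.+ i ℕ.+ j) ℕ.+ i ℕ.* j ℕ.* (3 ℕ.+ 2 ℕ.* i ℕ.+ j)) ℕ.+
         (s ℕ.+ i ℕ.* (1 ℕ.+ s) ℕ.+ i ℕ.+ j) ℕ.+ 2 ℕ.* r ℕ.* suc i) ≡
      suc i ℕ.* (2 ℕ.* (r ℕ.+ suc j ℕ.* (3 ℕ.+ 2 ℕ.* i ℕ.+ j)) ℕ.+ 1 ℕ.+ s) ℕ.+ (suc i ℕ.+ suc j)
    compare = ℕ-Solver.solve-∀

  -- `w * G k` is the deviation plus the main term, and the main term dominates the absolute value
  -- of the deviation. Writing M - k as `suc j` keeps k strictly below M.
  nonneg : .{{_ : ℕ.NonZero w}} → s ℕ.+ E ℕ.+ 2 ℕ.≤ M →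
           ∀ i j x → suc i ℕ.+ suc j ≡ M → x ℕ.+ suc i ℕ.* suc i ≡ n → 0ℤ ℤ.≤ G (suc i)
  nonneg large i j x k+d≡M x+k²≡n = ℤₚ.*-cancelˡ-≤-pos 0ℤ (G (suc i)) (+ w)
    {{ℤ.positive (ℤ.+<+ (ℕ.>-nonZero⁻¹ w))}} (begin
    + w ℤ.* 0ℤ                                         ≡⟨ ℤₚ.*-zeroʳ (+ w) ⟩
    0ℤ                                                 ≤⟨ 0≤i+m (deviation (suc i) x) (ℕₚ.≤-trans
                                                            (∣deviation∣≤ (suc j) i x k+d≡M x+k²≡n)
                                                            (bound≤main i j x k+d≡M large x+k²≡n)) ⟩
    deviation (suc i) x ℤ.+ + main (suc i) x           ≡⟨ deviation+main (suc i) x ⟩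
    + w ℤ.* G (suc i)                                  ∎)
    where
    open ℤₚ.≤-Reasoning
    0≤i+m : ∀ i {m} → ∣ i ∣ ℕ.≤ m → 0ℤ ℤ.≤ i ℤ.+ + m
    0≤i+m (+ _)    _    = ℤ.+≤+ z≤n
    0≤i+m -[1+ l ] {m} l<m = ℤₚ.≤-trans (ℤ.+≤+ z≤n) (ℤₚ.≤-reflexive (sym (ℤₚ.⊖-≥ l<m)))

-- The coefficients of the product

-- Associativity lets the three factors act one after another, each as a difference operator. The
-- index is a sum, so that no truncated subtraction occurs.
denominator·-shift : ∀ a b c g n →
  (denominator a b c · g) (a ℕ.+ (b ℕ.+ (c ℕ.+ n))) ≡
  ((g (c ℕ.+ (b ℕ.+ (a ℕ.+ n))) ℤ.- g (b ℕ.+ (a ℕ.+ n))) ℤ.- (g (c ℕ.+ (a ℕ.+ n)) ℤ.- g (a ℕ.+ n))) ℤ.-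
  ((g (c ℕ.+ (b ℕ.+ n)) ℤ.- g (b ℕ.+ n)) ℤ.- (g (c ℕ.+ n) ℤ.- g n))
denominator·-shift a b c g n = begin
  (denominator a b c · g) (a ℕ.+ (b ℕ.+ (c ℕ.+ n)))
    ≡⟨ trans (·-assoc ((1-q^ a) · (1-q^ b)) (1-q^ c) g _) (·-assoc (1-q^ a) (1-q^ b) ((1-q^ c) · g) _) ⟩
  ((1-q^ a) · f) (a ℕ.+ (b ℕ.+ (c ℕ.+ n)))
    ≡⟨ 1-q^a·g a f _ ⟩
  f (a ℕ.+ (b ℕ.+ (c ℕ.+ n))) ℤ.- f (b ℕ.+ (c ℕ.+ n))
    ≡⟨ cong₂ ℤ._-_ (trans (cong f (abc a b c n)) (f-shift (a ℕ.+ n))) (f-shift n) ⟩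
  _ ∎
  where
  open ≡-Reasoning
  f = (1-q^ b) · ((1-q^ c) · g)
  abc : ∀ a b c n → a ℕ.+ (b ℕ.+ (c ℕ.+ n)) ≡ b ℕ.+ (c ℕ.+ (a ℕ.+ n))
  abc = ℕ-Solver.solve-∀
  bc : ∀ b c n → b ℕ.+ (c ℕ.+ n) ≡ c ℕ.+ (b ℕ.+ n)
  bc = ℕ-Solver.solve-∀
  f-shift : ∀ m → f (b ℕ.+ (c ℕ.+ m)) ≡
            (g (c ℕ.+ (b ℕ.+ m)) ℤ.- g (b ℕ.+ m)) ℤ.- (g (c ℕ.+ m) ℤ.- g m)
  f-shift m = trans (1-q^a·g b ((1-q^ c) · g) (c ℕ.+ m)) (cong₂ ℤ._-_
    (trans (cong ((1-q^ c) · g) (bc b c m)) (1-q^a·g c g (b ℕ.+ m)))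
    (1-q^a·g c g m))

-- Reduces an identity that is stable under translation by `p` to the first `p` instances, which can
-- be evaluated.
period-induction : ∀ p .{{_ : NonZero p}} (R : ℕ → Set) →
                   (∀ {n} → n ℕ.< p → R n) → (∀ n → R n → R (p ℕ.+ n)) → ∀ n → R n
period-induction p R base step = <-rec R λ n ih → case n ih (ℕₚ.<-≤-connex n p)
  where
  case : ∀ n → (∀ {m} → m ℕ.< n → R m) → n ℕ.< p ⊎ p ℕ.≤ n → R n
  case n ih (inj₁ n<p) = base n<p
  case n ih (inj₂ p≤n) = subst R (ℕₚ.m+[n∸m]≡n p≤n) (step (n ∸ p) (ih (ℕₚ.∸-monoʳ-< (ℕ.>-nonZero⁻¹ p) p≤n)))

-- `M` is the integer square root: the bound on `r` says that n < (M+1)². Passing to n + 1 raises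
-- `r`, except at r = 2M, where n + 1 = (M+1)².
square-decomposition : ∀ n → ∃₂ λ M r → r ℕ.≤ M ℕ.+ M × r ℕ.+ M ℕ.* M ≡ n
square-decomposition zero = 0 , 0 , z≤n , refl
square-decomposition (suc n) with square-decomposition n
... | M , r , r≤2M , refl with ℕₚ.m≤n⇒m<n∨m≡n r≤2M
... | inj₁ r<2M = M , suc r , r<2M , refl
... | inj₂ refl = suc M , 0 , z≤n , lemma M
  where
  lemma : ∀ M → suc M ℕ.* suc M ≡ suc (M ℕ.+ M ℕ.+ M ℕ.* M)
  lemma = ℕ-Solver.solve-∀

-- Products of a series with the tails

module Alternation (P : ℕ → ℕ) where
  G : ℕ → ℕ → ℤ
  G k n = ((λ i → + P i) · tail k) n

  private
    shifted : ℕ → PowerSeries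
    shifted k = (λ i → + P i) · (q^² k)

    shifted-value : ∀ k {n} x → x ℕ.+ k ℕ.* k ≡ n → shifted k n ≡ + P x
    shifted-value k x refl = f·q^e (λ i → + P i) (k ℕ.* k) x

    G-sum : ∀ k n → G (suc k) n ℤ.+ G (suc (suc k)) n ≡ shifted (suc k) n ℤ.- shifted (suc (suc k)) n
    G-sum k n = begin
      G (suc k) n ℤ.+ G (suc (suc k)) n
        ≡⟨ ·-distribˡ-+ p (tail (suc k)) (tail (suc (suc k))) n ⟨
      (p · (λ i → tail (suc k) i ℤ.+ tail (suc (suc k)) i)) n
        ≡⟨ ·-congˡ p n (tail-step k) ⟩
      (p · (λ i → (q^² suc k) i ℤ.- (q^² suc (suc k)) i)) n
        ≡⟨ ·-distribˡ-+ p (q^² suc k) (λ i → ℤ.- (q^² suc (suc k)) i) n ⟩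
      shifted (suc k) n ℤ.+ (p · (λ i → ℤ.- (q^² suc (suc k)) i)) n
        ≡⟨ cong (λ i → shifted (suc k) n ℤ.+ i) (·-negʳ p (q^² suc (suc k)) n) ⟩
      shifted (suc k) n ℤ.- shifted (suc (suc k)) n ∎
      where
      open ≡-Reasoning
      p = λ i → + P i

  G-zero : ∀ k n → n ℕ.< suc k ℕ.* suc k → G (suc k) n ≡ 0ℤ
  G-zero k n n<k² = ·-zeroʳ (λ i → + P i) (tail (suc k)) n
    λ i i≤n → tail-zero k i (ℕₚ.≤-<-trans i≤n n<k²)

  G-step : ∀ n k x y → x ℕ.+ suc k ℕ.* suc k ≡ n → y ℕ.+ suc (suc k) ℕ.* suc (suc k) ≡ n →
           G (suc k) n ℤ.+ G (suc (suc k)) n ≡ + P x ℤ.- + P y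
  G-step n k x y x+k²≡n y+[1+k]²≡n = trans (G-sum k n)
    (cong₂ ℤ._-_ (shifted-value (suc k) x x+k²≡n) (shifted-value (suc (suc k)) y y+[1+k]²≡n))

  -- When (k+1)² ≤ n < (k+2)², the next `G` vanishes and the second monomial lies beyond degree `n`,
  -- so the sum of neighbours reduces to one value of `P`.
  G-last : ∀ k x n → x ℕ.+ suc k ℕ.* suc k ≡ n → n ℕ.< suc (suc k) ℕ.* suc (suc k) → G (suc k) n ≡ + P x
  G-last k x n x+k²≡n n<[1+k]² = begin
    G (suc k) n                                  ≡⟨ ℤₚ.+-identityʳ _ ⟨
    G (suc k) n ℤ.+ 0ℤ                           ≡⟨ cong (λ i → G (suc k) n ℤ.+ i) (G-zero (suc k) n n<[1+k]²) ⟨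
    G (suc k) n ℤ.+ G (suc (suc k)) n            ≡⟨ G-sum k n ⟩
    shifted (suc k) n ℤ.- shifted (suc (suc k)) n
      ≡⟨ cong₂ ℤ._-_ (shifted-value (suc k) x x+k²≡n)
           (f·q^e-below (λ i → + P i) (suc (suc k) ℕ.* suc (suc k)) n n<[1+k]²) ⟩
    + P x ℤ.- 0ℤ                                 ≡⟨ ℤₚ.+-identityʳ _ ⟩
    + P x ∎
    where open ≡-Reasoning

  -- For g = G k n it says that G k n, …, G 1 n, computed downwards by G-step, are nonnegative.
  Descends : ℕ → ℕ → ℤ → Set
  Descends n zero    g = ⊤
  Descends n (suc k) g =
    0ℤ ℤ.≤ g × Descends n k ((+ P (n ∸ k ℕ.* k) ℤ.- + P (n ∸ suc k ℕ.* suc k)) ℤ.- g)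

  descends? : ∀ n k g → Dec (Descends n k g)
  descends? n zero    g = yes tt
  descends? n (suc k) g = (0ℤ ℤ.≤? g) ×-dec descends? n k _

  -- The bound `k * k ≤ n` makes the truncated subtractions in `Descends` exact, so `G-step`
  -- identifies each value passed down with the next `G`.
  descends⇒nonneg : ∀ n k → k ℕ.* k ℕ.≤ n → Descends n k (G k n) → ∀ j → suc j ℕ.≤ k → 0ℤ ℤ.≤ G (suc j) n
  descends⇒nonneg n (suc k) k²≤n (0≤g , rest) j 1+j≤1+k with ℕₚ.m≤n⇒m<n∨m≡n 1+j≤1+k
  ... | inj₂ refl = 0≤g
  descends⇒nonneg n (suc zero)    k²≤n (0≤g , rest) j _ | inj₁ (s≤s ())
  descends⇒nonneg n (suc (suc k)) k²≤n (0≤g , rest) j _ | inj₁ (s≤s 1+j≤1+k) =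
    descends⇒nonneg n (suc k) [1+k]²≤n
      (subst (Descends n (suc k)) (sym (isolate _ _ _ (G-step n k _ _ (ℕₚ.m∸n+n≡m [1+k]²≤n) (ℕₚ.m∸n+n≡m k²≤n)))) rest)
      j 1+j≤1+k
    where
    [1+k]²≤n : suc k ℕ.* suc k ℕ.≤ n
    [1+k]²≤n = ℕₚ.≤-trans (ℕₚ.*-mono-≤ (ℕₚ.n≤1+n (suc k)) (ℕₚ.n≤1+n (suc k))) k²≤n
    isolate : ∀ g h d → g ℤ.+ h ≡ d → g ≡ d ℤ.- h
    isolate g h d refl = lemma g h
      where
      lemma : ∀ g h → g ≡ g ℤ.+ h ℤ.- h
      lemma = ℤ-Solver.solve-∀

-- Closed form of the reciprocal and nonnegativity for one triple

-- Intended for s = a+b+c, p = abc, κ = (p+s)/2 and E = 2p-1.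
module Triple (a b c s p κ E : ℕ) .{{_ : NonZero a}} .{{_ : NonZero b}} .{{_ : NonZero c}} .{{_ : NonZero p}}
  (1+E≡2p : suc E ≡ p ℕ.+ p) (p+s≡2κ : p ℕ.+ s ≡ κ ℕ.+ κ)
  where

  -- In the three cases treated, the number of ways to write `x` as a sum of parts `a`, `b`, `c`.
  -- The divisor 2abc appears as `suc E`, which is visibly nonzero.
  P : ℕ → ℕ
  P x = suc ((x ℕ.* x ℕ.+ s ℕ.* x) / suc E)

  open Alternation P

  -- Since `P` is the quotient plus one, `suc E * P x` exceeds the numerator by `suc E` minus the
  -- remainder, that is by 1 + ε x.
  ε : ℕ → ℕ
  ε x = E ∸ (x ℕ.* x ℕ.+ s ℕ.* x) % suc E

  ε≤E : ∀ x → ε x ℕ.≤ E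
  ε≤E x = ℕₚ.m∸n≤m E ((x ℕ.* x ℕ.+ s ℕ.* x) % suc E)

  P-quadratic : ∀ x → suc E ℕ.* P x ≡ x ℕ.* x ℕ.+ s ℕ.* x ℕ.+ 1 ℕ.+ ε x
  P-quadratic x = begin
    suc E ℕ.* suc (m / suc E)                  ≡⟨ lemma₁ (m / suc E) E ⟩
    m / suc E ℕ.* suc E ℕ.+ 1 ℕ.+ E
      ≡⟨ cong (λ e → m / suc E ℕ.* suc E ℕ.+ 1 ℕ.+ e) (ℕₚ.m+[n∸m]≡n (ℕₚ.≤-pred (m%n<n m (suc E)))) ⟨
    m / suc E ℕ.* suc E ℕ.+ 1 ℕ.+ (m % suc E ℕ.+ ε x) ≡⟨ lemma₂ (m / suc E ℕ.* suc E) (m % suc E) (ε x) ⟩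
    m % suc E ℕ.+ m / suc E ℕ.* suc E ℕ.+ 1 ℕ.+ ε x
      ≡⟨ cong (λ i → i ℕ.+ 1 ℕ.+ ε x) (m≡m%n+[m/n]*n m (suc E)) ⟨
    m ℕ.+ 1 ℕ.+ ε x ∎
    where
    open ≡-Reasoning
    m = x ℕ.* x ℕ.+ s ℕ.* x
    lemma₁ : ∀ q E → suc E ℕ.* suc q ≡ q ℕ.* suc E ℕ.+ 1 ℕ.+ E
    lemma₁ = ℕ-Solver.solve-∀
    lemma₂ : ∀ i j e → i ℕ.+ 1 ℕ.+ (j ℕ.+ e) ≡ j ℕ.+ i ℕ.+ 1 ℕ.+ e
    lemma₂ = ℕ-Solver.solve-∀

  -- The numerator grows by p(p+s) + 2px = 2p(κ + x), a multiple of the divisor, so the floor passes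
  -- through.
  P-shift : ∀ x → P (p ℕ.+ x) ≡ κ ℕ.+ x ℕ.+ P x
  P-shift x = begin
    suc (((p ℕ.+ x) ℕ.* (p ℕ.+ x) ℕ.+ s ℕ.* (p ℕ.+ x)) / suc E) ≡⟨ cong (λ m → suc (m / suc E)) shift ⟩
    suc (((κ ℕ.+ x) ℕ.* suc E ℕ.+ m) / suc E)
      ≡⟨ cong suc (+-distrib-/-∣ˡ m (n∣m*n (κ ℕ.+ x))) ⟩
    suc ((κ ℕ.+ x) ℕ.* suc E / suc E ℕ.+ m / suc E)
      ≡⟨ cong (λ i → suc (i ℕ.+ m / suc E)) (m*n/n≡m (κ ℕ.+ x) (suc E)) ⟩
    suc (κ ℕ.+ x ℕ.+ m / suc E)
      ≡⟨ ℕₚ.+-suc (κ ℕ.+ x) _ ⟨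
    κ ℕ.+ x ℕ.+ P x ∎
    where
    open ≡-Reasoning
    m = x ℕ.* x ℕ.+ s ℕ.* x
    lemma₁ : ∀ p x s → (p ℕ.+ x) ℕ.* (p ℕ.+ x) ℕ.+ s ℕ.* (p ℕ.+ x) ≡
                       p ℕ.* (p ℕ.+ s) ℕ.+ x ℕ.* (p ℕ.+ p) ℕ.+ (x ℕ.* x ℕ.+ s ℕ.* x)
    lemma₁ = ℕ-Solver.solve-∀
    lemma₂ : ∀ p x κ m → p ℕ.* (κ ℕ.+ κ) ℕ.+ x ℕ.* (p ℕ.+ p) ℕ.+ m ≡ (κ ℕ.+ x) ℕ.* (p ℕ.+ p) ℕ.+ m
    lemma₂ = ℕ-Solver.solve-∀
    shift : (p ℕ.+ x) ℕ.* (p ℕ.+ x) ℕ.+ s ℕ.* (p ℕ.+ x) ≡ (κ ℕ.+ x) ℕ.* suc E ℕ.+ m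
    shift = begin
      (p ℕ.+ x) ℕ.* (p ℕ.+ x) ℕ.+ s ℕ.* (p ℕ.+ x)        ≡⟨ lemma₁ p x s ⟩
      p ℕ.* (p ℕ.+ s) ℕ.+ x ℕ.* (p ℕ.+ p) ℕ.+ m          ≡⟨ cong (λ i → p ℕ.* i ℕ.+ x ℕ.* (p ℕ.+ p) ℕ.+ m) p+s≡2κ ⟩
      p ℕ.* (κ ℕ.+ κ) ℕ.+ x ℕ.* (p ℕ.+ p) ℕ.+ m          ≡⟨ lemma₂ p x κ m ⟩
      (κ ℕ.+ x) ℕ.* (p ℕ.+ p) ℕ.+ m                      ≡⟨ cong (λ w → (κ ℕ.+ x) ℕ.* w ℕ.+ m) 1+E≡2p ⟨
      (κ ℕ.+ x) ℕ.* suc E ℕ.+ m                          ∎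

  -- (1-q^a)(1-q^b)(1-q^c) · ∑ P(i) q^i has coefficient 0 at q^(a+b+c+n),
  -- with the negative terms moved to the right.
  Recurrence : ℕ → Set
  Recurrence n =
    P (c ℕ.+ (b ℕ.+ (a ℕ.+ n))) ℕ.+ P (a ℕ.+ n) ℕ.+ P (b ℕ.+ n) ℕ.+ P (c ℕ.+ n) ≡
    P (b ℕ.+ (a ℕ.+ n)) ℕ.+ P (c ℕ.+ (a ℕ.+ n)) ℕ.+ P (c ℕ.+ (b ℕ.+ n)) ℕ.+ P n

  recurrence? : ∀ n → Dec (Recurrence n)
  recurrence? n = _ ℕₚ.≟ _

  -- Both sides have four arguments with the same total 2(a+b+c) + 4n, so `P-shift` adds the same
  -- amount to each.
  recurrence-shift : ∀ n → Recurrence n → Recurrence (p ℕ.+ n)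
  recurrence-shift n rec = begin
    P (c ℕ.+ (b ℕ.+ (a ℕ.+ (p ℕ.+ n)))) ℕ.+ P (a ℕ.+ (p ℕ.+ n)) ℕ.+ P (b ℕ.+ (p ℕ.+ n)) ℕ.+ P (c ℕ.+ (p ℕ.+ n))
      ≡⟨ cong₂ ℕ._+_ (cong₂ ℕ._+_ (cong₂ ℕ._+_
           (at (move₃ c b a p n)) (at (move₁ a p n))) (at (move₁ b p n))) (at (move₁ c p n)) ⟩
    (κ ℕ.+ cba ℕ.+ P cba) ℕ.+ (κ ℕ.+ (a ℕ.+ n) ℕ.+ P (a ℕ.+ n)) ℕ.+
    (κ ℕ.+ (b ℕ.+ n) ℕ.+ P (b ℕ.+ n)) ℕ.+ (κ ℕ.+ (c ℕ.+ n) ℕ.+ P (c ℕ.+ n))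
      ≡⟨ collectˡ κ a b c n (P cba) (P (a ℕ.+ n)) (P (b ℕ.+ n)) (P (c ℕ.+ n)) ⟩
    4 ℕ.* κ ℕ.+ 2 ℕ.* (a ℕ.+ b ℕ.+ c ℕ.+ n ℕ.+ n) ℕ.+
    (P cba ℕ.+ P (a ℕ.+ n) ℕ.+ P (b ℕ.+ n) ℕ.+ P (c ℕ.+ n))
      ≡⟨ cong (λ i → 4 ℕ.* κ ℕ.+ 2 ℕ.* (a ℕ.+ b ℕ.+ c ℕ.+ n ℕ.+ n) ℕ.+ i) rec ⟩
    4 ℕ.* κ ℕ.+ 2 ℕ.* (a ℕ.+ b ℕ.+ c ℕ.+ n ℕ.+ n) ℕ.+
    (P ba ℕ.+ P ca ℕ.+ P cb ℕ.+ P n)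
      ≡⟨ collectʳ κ a b c n (P ba) (P ca) (P cb) (P n) ⟩
    (κ ℕ.+ ba ℕ.+ P ba) ℕ.+ (κ ℕ.+ ca ℕ.+ P ca) ℕ.+ (κ ℕ.+ cb ℕ.+ P cb) ℕ.+ (κ ℕ.+ n ℕ.+ P n)
      ≡⟨ cong₂ ℕ._+_ (cong₂ ℕ._+_ (cong₂ ℕ._+_
           (at (move₂ b a p n)) (at (move₂ c a p n))) (at (move₂ c b p n))) (P-shift n) ⟨
    P (b ℕ.+ (a ℕ.+ (p ℕ.+ n))) ℕ.+ P (c ℕ.+ (a ℕ.+ (p ℕ.+ n))) ℕ.+ P (c ℕ.+ (b ℕ.+ (p ℕ.+ n))) ℕ.+ P (p ℕ.+ n) ∎
    where
    open ≡-Reasoning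
    cba = c ℕ.+ (b ℕ.+ (a ℕ.+ n))
    ba = b ℕ.+ (a ℕ.+ n)
    ca = c ℕ.+ (a ℕ.+ n)
    cb = c ℕ.+ (b ℕ.+ n)
    at : ∀ {m m′} → m ≡ p ℕ.+ m′ → P m ≡ κ ℕ.+ m′ ℕ.+ P m′
    at {m′ = m′} refl = P-shift m′
    move₁ : ∀ i p n → i ℕ.+ (p ℕ.+ n) ≡ p ℕ.+ (i ℕ.+ n)
    move₁ = ℕ-Solver.solve-∀
    move₂ : ∀ i j p n → i ℕ.+ (j ℕ.+ (p ℕ.+ n)) ≡ p ℕ.+ (i ℕ.+ (j ℕ.+ n))
    move₂ = ℕ-Solver.solve-∀
    move₃ : ∀ i j k p n → i ℕ.+ (j ℕ.+ (k ℕ.+ (p ℕ.+ n))) ≡ p ℕ.+ (i ℕ.+ (j ℕ.+ (k ℕ.+ n)))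
    move₃ = ℕ-Solver.solve-∀
    collectˡ : ∀ κ a b c n w x y z →
      (κ ℕ.+ (c ℕ.+ (b ℕ.+ (a ℕ.+ n))) ℕ.+ w) ℕ.+ (κ ℕ.+ (a ℕ.+ n) ℕ.+ x) ℕ.+
      (κ ℕ.+ (b ℕ.+ n) ℕ.+ y) ℕ.+ (κ ℕ.+ (c ℕ.+ n) ℕ.+ z) ≡
      4 ℕ.* κ ℕ.+ 2 ℕ.* (a ℕ.+ b ℕ.+ c ℕ.+ n ℕ.+ n) ℕ.+ (w ℕ.+ x ℕ.+ y ℕ.+ z)
    collectˡ = ℕ-Solver.solve-∀
    collectʳ : ∀ κ a b c n w x y z →
      4 ℕ.* κ ℕ.+ 2 ℕ.* (a ℕ.+ b ℕ.+ c ℕ.+ n ℕ.+ n) ℕ.+ (w ℕ.+ x ℕ.+ y ℕ.+ z) ≡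
      (κ ℕ.+ (b ℕ.+ (a ℕ.+ n)) ℕ.+ w) ℕ.+ (κ ℕ.+ (c ℕ.+ (a ℕ.+ n)) ℕ.+ x) ℕ.+
      (κ ℕ.+ (c ℕ.+ (b ℕ.+ n)) ℕ.+ y) ℕ.+ (κ ℕ.+ n ℕ.+ z)
    collectʳ = ℕ-Solver.solve-∀

  initial? : ∀ n → Dec ((denominator a b c · (λ i → + P i)) n ≡ (q^ 0ℤ) n)
  initial? n = _ ℤ.≟ _

  -- Treats all `n` with integer square root `M` together; the descent starts from the value `P r`
  -- that `G-last` provides.
  SmallCase : ℕ → Set
  SmallCase M = ∀ {r} → r ℕ.< suc (M ℕ.+ M) → Descends (r ℕ.+ M ℕ.* M) M (+ P r)

  smallCase? : ∀ M → Dec (SmallCase M)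
  smallCase? M = ℕₚ.allUpTo? (λ r → descends? (r ℕ.+ M ℕ.* M) M (+ P r)) (suc (M ℕ.+ M))

  -- These three facts are decidable, so each concrete triple can supply them by evaluation.
  module _
    (recurrence-base : ∀ {n} → n ℕ.< p → Recurrence n)
    (initial : ∀ {n} → n ℕ.< a ℕ.+ (b ℕ.+ c) → (denominator a b c · (λ i → + P i)) n ≡ (q^ 0ℤ) n)
    (smallCases : ∀ {M} → M ℕ.< s ℕ.+ E ℕ.+ 2 → SmallCase M)
    where

    -- Below degree a+b+c this is evaluated; from there on the coefficient is the eight-term
    -- difference that `Recurrence` makes vanish.
    denominator·P : ∀ n → (denominator a b c · (λ i → + P i)) n ≡ (q^ 0ℤ) n
    denominator·P n with ℕₚ.<-≤-connex n (a ℕ.+ (b ℕ.+ c))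
    ... | inj₁ n<s = initial n<s
    ... | inj₂ s≤n = subst (λ n → (denominator a b c · (λ i → + P i)) n ≡ (q^ 0ℤ) n) index (begin
      (denominator a b c · (λ i → + P i)) (a ℕ.+ (b ℕ.+ (c ℕ.+ m)))
        ≡⟨ denominator·-shift a b c (λ i → + P i) m ⟩
      ((+ P (c ℕ.+ (b ℕ.+ (a ℕ.+ m))) ℤ.- + P (b ℕ.+ (a ℕ.+ m))) ℤ.- (+ P (c ℕ.+ (a ℕ.+ m)) ℤ.- + P (a ℕ.+ m))) ℤ.-
      ((+ P (c ℕ.+ (b ℕ.+ m)) ℤ.- + P (b ℕ.+ m)) ℤ.- (+ P (c ℕ.+ m) ℤ.- + P m))
        ≡⟨ rearrange (+ P (c ℕ.+ (b ℕ.+ (a ℕ.+ m)))) (+ P (b ℕ.+ (a ℕ.+ m))) (+ P (c ℕ.+ (a ℕ.+ m)))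
             (+ P (a ℕ.+ m)) (+ P (c ℕ.+ (b ℕ.+ m))) (+ P (b ℕ.+ m)) (+ P (c ℕ.+ m)) (+ P m) ⟩
      + (P (c ℕ.+ (b ℕ.+ (a ℕ.+ m))) ℕ.+ P (a ℕ.+ m) ℕ.+ P (b ℕ.+ m) ℕ.+ P (c ℕ.+ m)) ℤ.-
      + (P (b ℕ.+ (a ℕ.+ m)) ℕ.+ P (c ℕ.+ (a ℕ.+ m)) ℕ.+ P (c ℕ.+ (b ℕ.+ m)) ℕ.+ P m)
        ≡⟨ ℤₚ.i≡j⇒i-j≡0 (cong +_ (period-induction p Recurrence recurrence-base recurrence-shift m)) ⟩
      0ℤ
        ≡⟨ q^-zero {0ℤ} {a ℕ.+ (b ℕ.+ (c ℕ.+ m))} (λ 0≡ → ℕ.≢-nonZero⁻¹ a (ℕₚ.m+n≡0⇒m≡0 a (sym (ℤₚ.+-injective 0≡)))) ⟨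
      (q^ 0ℤ) (a ℕ.+ (b ℕ.+ (c ℕ.+ m))) ∎)
      where
      open ≡-Reasoning
      m = n ∸ (a ℕ.+ (b ℕ.+ c))
      index : a ℕ.+ (b ℕ.+ (c ℕ.+ m)) ≡ n
      index = trans (lemma a b c m) (ℕₚ.m+[n∸m]≡n s≤n)
        where
        lemma : ∀ a b c m → a ℕ.+ (b ℕ.+ (c ℕ.+ m)) ≡ a ℕ.+ (b ℕ.+ c) ℕ.+ m
        lemma = ℕ-Solver.solve-∀
      rearrange : ∀ cba ba ca a cb b c o →
        ((cba ℤ.- ba) ℤ.- (ca ℤ.- a)) ℤ.- ((cb ℤ.- b) ℤ.- (c ℤ.- o)) ≡
        (cba ℤ.+ a ℤ.+ b ℤ.+ c) ℤ.- (ba ℤ.+ ca ℤ.+ cb ℤ.+ o)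
      rearrange = ℤ-Solver.solve-∀

    γ≡G : ∀ k n → γ a b c 1 0ℤ k n ≡ G k n
    γ≡G k n = ·-congʳ (tail k) n (⁻¹-unique (denominator a b c) (λ i → + P i) (denominator₀ a b c) denominator·P)

    -- Compares the index with the integer square root M of `n`: above M the value is zero, at M it
    -- is a value of `P`, and below M either the evaluated cases or the growth estimate applies.
    G-nonneg : ∀ k n → 0ℤ ℤ.≤ G (suc k) n
    G-nonneg k n with square-decomposition n
    ... | M , r , r≤2M , r+M²≡n = compare M r r≤2M r+M²≡n (ℕₚ.<-cmp (suc k) M)
      where
      n<[1+M]² : ∀ M r → r ℕ.≤ M ℕ.+ M → r ℕ.+ M ℕ.* M ≡ n → n ℕ.< suc M ℕ.* suc M
      n<[1+M]² M r r≤2M refl = ℕₚ.≤-trans (s≤s (ℕₚ.+-monoˡ-≤ (M ℕ.* M) r≤2M)) (ℕₚ.≤-reflexive (lemma M))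
        where
        lemma : ∀ M → suc (M ℕ.+ M ℕ.+ M ℕ.* M) ≡ suc M ℕ.* suc M
        lemma = ℕ-Solver.solve-∀
      compare : ∀ M r → r ℕ.≤ M ℕ.+ M → r ℕ.+ M ℕ.* M ≡ n →
                Tri (suc k ℕ.< M) (suc k ≡ M) (M ℕ.< suc k) → 0ℤ ℤ.≤ G (suc k) n
      compare M r r≤2M r+M²≡n (tri> _ _ M<k) = ℤₚ.≤-reflexive (sym (G-zero k n
        (ℕₚ.<-≤-trans (n<[1+M]² M r r≤2M r+M²≡n) (ℕₚ.*-mono-≤ M<k M<k))))
      compare M r r≤2M r+M²≡n (tri≈ _ refl _) =
        subst (0ℤ ℤ.≤_) (sym (G-last k r n r+M²≡n (n<[1+M]² M r r≤2M r+M²≡n))) (ℤ.+≤+ z≤n)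
      -- The threshold `s + E + 2` is s + w + 1 with w = `suc E`.
      compare (suc M) r r≤2M r+M²≡n (tri< k<M _ _) with ℕₚ.<-≤-connex (suc M) (s ℕ.+ E ℕ.+ 2)
      ... | inj₁ small = descends⇒nonneg n (suc M)
        (ℕₚ.≤-trans (ℕₚ.m≤n+m _ r) (ℕₚ.≤-reflexive r+M²≡n))
        (subst₂ (λ n g → Descends n (suc M) g) r+M²≡n (sym last) (smallCases small (s≤s r≤2M)))
        k (ℕₚ.<⇒≤ k<M)
        where last = G-last M r n r+M²≡n (n<[1+M]² (suc M) r r≤2M r+M²≡n)
      -- The square root is `suc M` here, so `M ∸ suc k` is one less than its distance from `suc k`.
      ... | inj₂ large = nonneg large k (M ∸ suc k) (n ∸ suc k ℕ.* suc k)
        (trans (ℕₚ.+-suc (suc k) _) (cong suc (ℕₚ.m+[n∸m]≡n (ℕₚ.≤-pred k<M))))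
        (ℕₚ.m∸n+n≡m (ℕₚ.≤-trans (ℕₚ.*-mono-≤ (ℕₚ.<⇒≤ k<M) (ℕₚ.<⇒≤ k<M))
                      (ℕₚ.≤-trans (ℕₚ.m≤n+m _ r) (ℕₚ.≤-reflexive r+M²≡n))))
        where
        open Alternating s (suc E) E P ε P-quadratic ε≤E n (λ k → G k n) (G-step n)
          (suc M) r r≤2M r+M²≡n (G-last M r n r+M²≡n (n<[1+M]² (suc M) r r≤2M r+M²≡n))

    γ-nonneg : ∀ k n → k ℕ.≥ 1 → 0ℤ ℤ.≤ γ a b c 1 0ℤ k n
    γ-nonneg (suc k) n _ = subst (0ℤ ℤ.≤_) (sym (γ≡G (suc k) n)) (G-nonneg k n)

-- Finite checks for the three triples

module Triple123 = Triple 1 2 3 6 6 6 11 refl refl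
γ123-nonneg : ∀ k n → k ≥ 1 → 0ℤ ≤ γ 1 2 3 1 0ℤ k n
γ123-nonneg = Triple123.γ-nonneg
  -- The three bounds are p, a+b+c and s+E+2, here and for the other triples.
  (from-yes (ℕₚ.allUpTo? Triple123.recurrence? 6))
  (from-yes (ℕₚ.allUpTo? Triple123.initial? 6))
  (from-yes (ℕₚ.allUpTo? Triple123.smallCase? 19))

module Triple125 = Triple 1 2 5 8 10 9 19 refl refl
γ125-nonneg : ∀ k n → k ≥ 1 → 0ℤ ≤ γ 1 2 5 1 0ℤ k n
γ125-nonneg = Triple125.γ-nonneg
  (from-yes (ℕₚ.allUpTo? Triple125.recurrence? 10))
  (from-yes (ℕₚ.allUpTo? Triple125.initial? 8))
  (from-yes (ℕₚ.allUpTo? Triple125.smallCase? 29))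

module Triple135 = Triple 1 3 5 9 15 12 29 refl refl
γ135-nonneg : ∀ k n → k ≥ 1 → 0ℤ ≤ γ 1 3 5 1 0ℤ k n
γ135-nonneg = Triple135.γ-nonneg
  (from-yes (ℕₚ.allUpTo? Triple135.recurrence? 15))
  (from-yes (ℕₚ.allUpTo? Triple135.initial? 9))
  (from-yes (ℕₚ.allUpTo? Triple135.smallCase? 40))

corollary2p4 : (k n : ℕ) → k ≥ 1 → (a b c : ℕ) →
    (a , b , c) ∈ (1 , 2 , 3) ∷ (1 , 2 , 5) ∷ (1 , 3 , 5) ∷ [] →
    0ℤ ≤ γ a b c 1 0ℤ k n
corollary2p4 k n k≥1 a b c (here refl)                 = γ123-nonneg k n k≥1
corollary2p4 k n k≥1 a b c (there (here refl))         = γ125-nonneg k n k≥1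
corollary2p4 k n k≥1 a b c (there (there (here refl))) = γ135-nonneg k n k≥1
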